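{- The categories $\mathsf{MoSL}$ (modal semilattices and modal homomorphisms) and $\mathsf{MoSsp}$ (MoS-spaces and compatible meet-relations) are dually equivalent, i.e. $\mathsf{MoSL}^{op}$ is equivalent to $\mathsf{MoSsp}$.
   Context: **$\mathsf{MoSL}$.** A semilattice is a meet-semilattice with greatest element $\mathbf{A}=\langle A,\wedge,1\rangle$; homomorphisms preserve $\wedge$ and $1$. A modal semilattice is $\langle\mathbf{A},d\rangle$ with $\mathbf{A}$ a semilattice and $d:A\to A$ satisfying $d(1)=1$ and $d(a\wedge b)=d(a)\wedge d(b)$. A modal homomorphism $h:\langle\mathbf{A},d\rangle\to\langle\mathbf{B},n\rangle$ is a semilattice homomorphism with $h(d(a))=n(h(a))$ for all $a\in A$. **S-spaces.** Let $X$ be a set and $\mathcal{K}\subseteq\mathcal{P}(X)$, regarded as a subbase of a topology on $X$. Put $S(X)=\{U^c: U\in\mathcal{K}\}$ and $\mathcal{C}_{\mathcal{K}}(X)=\{\bigcap\mathcal{A}:\mathcal{A}\subseteq S(X)\}$ (with $\bigcap\emptyset=X$). For $Y\subseteq X$, a family $\mathcal{J}\subseteq S(X)$ is a $Y$-family if for all $A,B\in\mathcal{J}$ there are $H\in S(X)$, $C\in\mathcal{J}$ with $Y\subseteq H$, $A\cap H\subseteq C$ and $B\cap H\subseteq C$. $\langle X,\mathcal{K}\rangle$ is an S-space if: (S1) the topology is $T_0$ and $X=\bigcup\mathcal{K}$; (S2) $\mathcal{K}$ is a subbase of compact open sets, closed under finite unions, and $\emptyset\in\mathcal{K}$; (S3)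 if $x\in U\cap V$ with $U,V\in\mathcal{K}$, there are $W,D\in\mathcal{K}$ with $x\notin W$, $x\in D$, $D\subseteq(U\cap V)\cup W$; (S4) if $Y\in\mathcal{C}_{\mathcal{K}}(X)$ and $\mathcal{J}\subseteq S(X)$ is a $Y$-family with $Y\cap A^c\neq\emptyset$ for all $A\in\mathcal{J}$, then $Y\cap\bigcap\{A^c:A\in\mathcal{J}\}\neq\emptyset$. Put $\mathrm{cl}_{\mathcal{K}}(x)=\bigcap\{U\in S(X):x\in U\}$. The dual specialization order is: $x\sqsupseteq y$ iff $y\in\mathrm{cl}_{\mathcal{K}}(x)$. **Meet-relations.** For $T\subseteq X\times Y$ write $T(x)=\{y:(x,y)\in T\}$ and $\Box_T(U)=\{x\in X:T(x)\subseteq U\}$. A meet-relation between S-spaces $\langle X_1,\mathcal{K}_1\rangle$ and $\langle X_2,\mathcal{K}_2\rangle$ is $T\subseteq X_1\times X_2$ such that $\Box_T(U)\in S(X_1)$ for all $U\in S(X_2)$, and $T(x)=\bigcap\{U\in S(X_2):T(x)\subseteq U\}$ for all $x\in X_1$. For meet-relations $R\subseteq X_1\times X_2$, $T\subseteq X_2\times X_3$, the composition is $T*R=\{(x,z)\in X_1\times X_3:\forall U\in S(X_3)\,((T\circ R)(x)\subseteq U\Rightarrow z\in U)\}$, where $(T\circ R)(x)=\bigcup_{y\in R(x)}T(y)$. **$\mathsf{MoSsp}$.** A MoS-space is $\langle X,\mathcal{K},T\rangle$ with $\langle X,\mathcal{K}\rangle$ an S-space and $T\subseteq X\times X$ a meet-relation.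 A meet-relation $M\subseteq X\times Y$ between MoS-spaces $\langle X,\mathcal{K}_X,T_1\rangle$ and $\langle Y,\mathcal{K}_Y,T_2\rangle$ is compatible if $M*T_1=T_2*M$. $\mathsf{MoSsp}$ has MoS-spaces as objects, compatible meet-relations as morphisms, composition $*$, and identities $\sqsupseteq_X$.
   Formalization: Y-families are required to be nonempty: since X = ⋃K puts the empty set in C_K(X), allowing the empty Y-family in (S4) would demand a point of the empty set, so no S-space would exist and the duality would fail. -}

module Defs where

open import Level using (Level; _⊔_; suc)
open import Algebra.Bundles.Raw using (RawMonoid)
open import Algebra.Lattice.Bundles using (BoundedMeetSemilattice)
open import Algebra.Morphism.Structures using (module MonoidMorphisms)
import Algebra.Morphism.Construct.Composition as Composition
import Algebra.Morphism.Construct.Identity as Identity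
open import Data.List.Base using (List)
open import Data.List.Relation.Unary.All using (All)
open import Data.List.Relation.Unary.Any using (Any)
open import Data.Product.Base using (_×_; _,_; proj₁; proj₂; ∃)
open import Data.Sum.Base using (_⊎_)
open import Function.Base using (_∘_)
open import Relation.Binary.Construct.Composition using () renaming (_;_ to _⨟_)
open import Relation.Binary.Core using (REL; Rel; _⇔_)
open import Relation.Binary.PropositionalEquality.Core using (_≢_)
open import Relation.Binary.Structures using (IsEquivalence)
open import Relation.Unary
  using (Pred; _∈_; _∉_; _⊆_; _≐_; _∩_; _∪_; ∁; _≬_; Satisfiable)
open import Relation.Unary.Polymorphic using (∅; U)

record Category (o h e : Level) : Set (suc (o ⊔ h ⊔ e)) where
  infix  4 _≈_
  infixr 9 _∘ᶜ_
  field
    Obj       : Set o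
    Hom       : Rel Obj h
    _≈_       : ∀ {A B} → Rel (Hom A B) e
    id        : ∀ {A} → Hom A A
    _∘ᶜ_      : ∀ {A B C} → Hom B C → Hom A B → Hom A C
    equiv     : ∀ {A B} → IsEquivalence (_≈_ {A} {B})
    ∘-resp-≈  : ∀ {A B C} {f f′ : Hom B C} {g g′ : Hom A B} →
                f ≈ f′ → g ≈ g′ → f ∘ᶜ g ≈ f′ ∘ᶜ g′
    assoc     : ∀ {A B C D} {f : Hom A B} {g : Hom B C} {k : Hom C D} →
                (k ∘ᶜ g) ∘ᶜ f ≈ k ∘ᶜ (g ∘ᶜ f)
    identityˡ : ∀ {A B} {f : Hom A B} → id ∘ᶜ f ≈ f
    identityʳ : ∀ {A B} {f : Hom A B} → f ∘ᶜ id ≈ f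

infix 10 _ᵒᵖ

_ᵒᵖ : ∀ {o h e} → Category o h e → Category o h e
C ᵒᵖ = record
  { Obj       = Obj
  ; Hom       = λ A B → Hom B A
  ; _≈_       = _≈_
  ; id        = id
  ; _∘ᶜ_      = λ f g → g ∘ᶜ f
  ; equiv     = equiv
  ; ∘-resp-≈  = λ p q → ∘-resp-≈ q p
  ; assoc     = IsEquivalence.sym equiv assoc
  ; identityˡ = identityʳ
  ; identityʳ = identityˡ
  } where open Category C

record Functor {o h e o′ h′ e′} (C : Category o h e) (D : Category o′ h′ e′) :
               Set (o ⊔ h ⊔ e ⊔ o′ ⊔ h′ ⊔ e′) where
  private
    module C = Category C
    module D = Category D
  field
    F₀       : C.Obj → D.Obj
    F₁       : ∀ {A B} → C.Hom A B → D.Hom (F₀ A) (F₀ B)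
    F-resp-≈ : ∀ {A B} {f g : C.Hom A B} → f C.≈ g → F₁ f D.≈ F₁ g
    F-id     : ∀ {A} → F₁ (C.id {A}) D.≈ D.id
    F-∘      : ∀ {A B C} {f : C.Hom A B} {g : C.Hom B C} →
               F₁ (g C.∘ᶜ f) D.≈ F₁ g D.∘ᶜ F₁ f

idF : ∀ {o h e} {C : Category o h e} → Functor C C
idF {C = C} = record
  { F₀       = λ A → A
  ; F₁       = λ f → f
  ; F-resp-≈ = λ p → p
  ; F-id     = IsEquivalence.refl equiv
  ; F-∘      = IsEquivalence.refl equiv
  } where open Category C

infixr 9 _∘F_

_∘F_ : ∀ {o h e o′ h′ e′ o″ h″ e″}
       {C : Category o h e} {D : Category o′ h′ e′} {E : Category o″ h″ e″} →
       Functor D E → Functor C D → Functor C E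
_∘F_ {E = E} G F = record
  { F₀       = G.F₀ ∘ F.F₀
  ; F₁       = G.F₁ ∘ F.F₁
  ; F-resp-≈ = G.F-resp-≈ ∘ F.F-resp-≈
  ; F-id     = trans (G.F-resp-≈ F.F-id) G.F-id
  ; F-∘      = trans (G.F-resp-≈ F.F-∘) G.F-∘
  } where
    module F = Functor F
    module G = Functor G
    open module E {A B} = IsEquivalence (Category.equiv E {A} {B}) using (trans)

record NaturalIsomorphism {o h e o′ h′ e′}
         {C : Category o h e} {D : Category o′ h′ e′} (F G : Functor C D) :
         Set (o ⊔ h ⊔ e ⊔ o′ ⊔ h′ ⊔ e′) where
  private
    module C = Category C
    module F = Functor F
    module G = Functor G
  open Category D
  field
    to      : ∀ A → Hom (F.F₀ A) (G.F₀ A)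
    from    : ∀ A → Hom (G.F₀ A) (F.F₀ A)
    natural : ∀ {A B} (f : C.Hom A B) → to B ∘ᶜ F.F₁ f ≈ G.F₁ f ∘ᶜ to A
    from∘to : ∀ A → from A ∘ᶜ to A ≈ id
    to∘from : ∀ A → to A ∘ᶜ from A ≈ id

record Equivalence {o h e o′ h′ e′}
         (C : Category o h e) (D : Category o′ h′ e′) :
         Set (o ⊔ h ⊔ e ⊔ o′ ⊔ h′ ⊔ e′) where
  field
    F      : Functor C D
    G      : Functor D C
    unit   : NaturalIsomorphism (idF {C = C}) (G ∘F F)
    counit : NaturalIsomorphism (F ∘F G) (idF {C = D})

rawMonoid : ∀ {c ℓ} → BoundedMeetSemilattice c ℓ → RawMonoid c ℓ
rawMonoid A = record { _≈_ = _≈_ ; _∙_ = _∧_ ; ε = ⊤ }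
  where open BoundedMeetSemilattice A

IsSemilatticeHom : ∀ {c ℓ} (A B : BoundedMeetSemilattice c ℓ) →
  (BoundedMeetSemilattice.Carrier A → BoundedMeetSemilattice.Carrier B) →
  Set (c ⊔ ℓ)
IsSemilatticeHom A B =
  MonoidMorphisms.IsMonoidHomomorphism (rawMonoid A) (rawMonoid B)

record ModalSemilattice (ℓ : Level) : Set (suc ℓ) where
  field
    semilattice : BoundedMeetSemilattice ℓ ℓ
  open BoundedMeetSemilattice semilattice public hiding (semilattice)
  field
    d       : Carrier → Carrier
    d-isHom : IsSemilatticeHom semilattice semilattice d

record ModalHom {ℓ} (A B : ModalSemilattice ℓ) : Set ℓ where
  private
    module A = ModalSemilattice A
    module B = ModalSemilattice B
  field
    fun   : A.Carrier → B.Carrier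
    isHom : IsSemilatticeHom A.semilattice B.semilattice fun
    modal : ∀ a → fun (A.d a) B.≈ B.d (fun a)

MoSL : (ℓ : Level) → Category (suc ℓ) ℓ ℓ
MoSL ℓ = record
  { Obj       = ModalSemilattice ℓ
  ; Hom       = ModalHom
  ; _≈_       = λ {A} {B} f g → ∀ a → _≈_ B (fun f a) (fun g a)
  ; id        = λ {A} → record
    { fun   = λ a → a
    ; isHom = Identity.isMonoidHomomorphism (rawMonoid (semilattice A)) (refl A)
    ; modal = λ _ → refl A
    }
  ; _∘ᶜ_      = λ {A} {B} {C} g f → record
    { fun   = fun g ∘ fun f
    ; isHom = Composition.isMonoidHomomorphism (trans C) (isHom f) (isHom g)
    ; modal = λ a → trans C (cong g (modal f a)) (modal g (fun f a))
    }
  ; equiv     = λ {A} {B} → record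
    { refl  = λ _ → refl B
    ; sym   = λ p a → sym B (p a)
    ; trans = λ p q a → trans B (p a) (q a)
    }
  ; ∘-resp-≈  = λ {A} {B} {C} {f} {_} {_} {g′} p q a →
                  trans C (cong f (q a)) (p (fun g′ a))
  ; assoc     = λ {A} {B} {C} {D} _ → refl D
  ; identityˡ = λ {A} {B} _ → refl B
  ; identityʳ = λ {A} {B} _ → refl B
  } where
    open ModalSemilattice
    open ModalHom
    cong : {A B : ModalSemilattice ℓ} (f : ModalHom A B) {x y : Carrier A} →
           _≈_ A x y → _≈_ B (fun f x) (fun f y)
    cong f = MonoidMorphisms.IsMonoidHomomorphism.⟦⟧-cong (isHom f)

-- Subsets of X : Set ℓ are predicates X → Set ℓ, compared by _≐_, while
-- families of subsets and binary relations are predicates valued in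
-- Set (suc ℓ), so that quantifying over subsets stays within that level.
-- Under excluded middle every proposition is equivalent to one in Set ℓ,
-- hence nothing is lost by fixing these levels.

Family : ∀ {ℓ} → Set ℓ → Set (suc (suc ℓ))
Family {ℓ} X = Pred (Pred X ℓ) (suc ℓ)

module _ {ℓ : Level} {X : Set ℓ} where

  ⋃₀ ⋂₀ : Family X → Pred X (suc ℓ)
  ⋃₀ 𝒜 x = ∃ λ A → A ∈ 𝒜 × x ∈ A
  ⋂₀ 𝒜 x = ∀ A → A ∈ 𝒜 → x ∈ A

  -- The topology with subbase 𝒦: the least one containing 𝒦.  In
  -- particular the compact open sets of S2 are open by construction, and the
  -- empty set is open as the union of the empty family.
  data Open (𝒦 : Family X) : Pred X ℓ → Set (suc (suc ℓ)) where
    subbasic : ∀ {V} → V ∈ 𝒦 → Open 𝒦 V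
    whole    : Open 𝒦 U
    meet     : ∀ {V W} → Open 𝒦 V → Open 𝒦 W → Open 𝒦 (V ∩ W)
    union    : ∀ {V} (𝒜 : Family X) → (∀ A → A ∈ 𝒜 → Open 𝒦 A) →
               V ≐ ⋃₀ 𝒜 → Open 𝒦 V

  Compact : Family X → Pred X ℓ → Set (suc (suc ℓ))
  Compact 𝒦 V = (𝒜 : Family X) → (∀ A → A ∈ 𝒜 → Open 𝒦 A) → V ⊆ ⋃₀ 𝒜 →
    ∃ λ (As : List (Pred X ℓ)) →
      All (_∈ 𝒜) As × (∀ x → x ∈ V → Any (x ∈_) As)

  T₀ : Family X → Set (suc (suc ℓ))
  T₀ 𝒦 = ∀ x y → x ≢ y →
    ∃ λ V → Open 𝒦 V × ((x ∈ V × y ∉ V) ⊎ (x ∉ V × y ∈ V))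

  -- The argument A may live in any universe because _∈ S 𝒦 is also
  -- asserted of subsets of the form □ T V, which land one level higher.
  S : Family X → ∀ {a} → Pred X a → Set (suc ℓ ⊔ a)
  S 𝒦 A = ∃ λ V → V ∈ 𝒦 × A ≐ ∁ V

  𝒞 : Family X → Pred X ℓ → Set (suc (suc ℓ))
  𝒞 𝒦 Y = ∃ λ (𝒜 : Family X) → (∀ A → A ∈ 𝒜 → S 𝒦 A) × Y ≐ ⋂₀ 𝒜

  -- Families are required to be nonempty: ∅ = ⋂ S(X) always belongs to
  -- 𝒞 𝒦, so allowing 𝒥 = ∅ below would make axiom S4 unsatisfiable.
  record IsYFamily (𝒦 : Family X) (Y : Pred X ℓ) (𝒥 : Family X) :
                   Set (suc ℓ) where
    field
      nonempty : Satisfiable 𝒥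
      ⊆S       : ∀ A → A ∈ 𝒥 → S 𝒦 A
      directed : ∀ A B → A ∈ 𝒥 → B ∈ 𝒥 → ∃ λ (H : Pred X ℓ) → ∃ λ C →
                 S 𝒦 H × C ∈ 𝒥 × Y ⊆ H × (A ∩ H) ⊆ C × (B ∩ H) ⊆ C

  record IsSSpace (𝒦 : Family X) : Set (suc (suc ℓ)) where
    field
      S1-T₀      : T₀ 𝒦
      S1-cover   : ∀ x → x ∈ ⋃₀ 𝒦
      S2-compact : ∀ V → V ∈ 𝒦 → Compact 𝒦 V
      S2-∪       : ∀ V W → V ∈ 𝒦 → W ∈ 𝒦 → (V ∪ W) ∈ 𝒦
      S2-∅       : ∅ ∈ 𝒦
      S3         : ∀ x V₁ V₂ → V₁ ∈ 𝒦 → V₂ ∈ 𝒦 → x ∈ (V₁ ∩ V₂) →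
                  ∃ λ W → ∃ λ D → W ∈ 𝒦 × D ∈ 𝒦 ×
                    x ∉ W × x ∈ D × D ⊆ ((V₁ ∩ V₂) ∪ W)
      S4         : ∀ Y 𝒥 → 𝒞 𝒦 Y → IsYFamily 𝒦 Y 𝒥 →
                  (∀ A → A ∈ 𝒥 → Y ≬ ∁ A) →
                  Y ≬ (λ x → ∀ A → A ∈ 𝒥 → x ∈ ∁ A)

record SSpace (ℓ : Level) : Set (suc (suc ℓ)) where
  field
    Point    : Set ℓ
    𝒦        : Family Point
    𝒦-resp-≐ : ∀ {V W} → V ≐ W → V ∈ 𝒦 → W ∈ 𝒦
    isSSpace : IsSSpace 𝒦

open SSpace using (Point; 𝒦)

cl : ∀ {ℓ} (𝕏 : SSpace ℓ) → Point 𝕏 → Pred (Point 𝕏) (suc ℓ)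
cl 𝕏 x = ⋂₀ λ V → S (𝒦 𝕏) V × x ∈ V

-- The dual specialization order, used in prefix form.
⊒ : ∀ {ℓ} (𝕏 : SSpace ℓ) → Rel (Point 𝕏) (suc ℓ)
⊒ 𝕏 x y = y ∈ cl 𝕏 x

□ : ∀ {a b r u} {X : Set a} {Y : Set b} → REL X Y r → Pred Y u →
    Pred X (b ⊔ r ⊔ u)
□ T V x = T x ⊆ V

record MeetRelation {ℓ} (𝕏 𝕐 : SSpace ℓ) : Set (suc (suc ℓ)) where
  field
    rel      : REL (Point 𝕏) (Point 𝕐) (suc ℓ)
    □-closed : (V : Pred (Point 𝕐) ℓ) → S (𝒦 𝕐) V → S (𝒦 𝕏) (□ rel V)
    rel-⋂    : ∀ x → rel x ≐ ⋂₀ λ V → S (𝒦 𝕐) V × rel x ⊆ V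

open MeetRelation

private
  ≐-S : ∀ {ℓ} {X : Set ℓ} {𝒦 : Family X} {a b} {A : Pred X a} {B : Pred X b} →
        A ≐ B → S 𝒦 A → S 𝒦 B
  ≐-S (p , q) (V , V∈𝒦 , r , s) = V , V∈𝒦 , r ∘ q , p ∘ s

  ∈-upward : ∀ {ℓ} (𝕏 : SSpace ℓ) {a} {V : Pred (Point 𝕏) a} → S (𝒦 𝕏) V →
             ∀ {x} → x ∈ V → cl 𝕏 x ⊆ V
  ∈-upward 𝕏 (W , W∈𝒦 , p , q) x∈V y∈cl =
    q (y∈cl (∁ W) ((W , W∈𝒦 , (λ z → z) , (λ z → z)) , p x∈V))

⊒-meet : ∀ {ℓ} {𝕏 : SSpace ℓ} → MeetRelation 𝕏 𝕏
⊒-meet {𝕏 = 𝕏} = record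
  { rel      = ⊒ 𝕏
  ; □-closed = λ V V∈S → ≐-S (∈-upward 𝕏 V∈S , λ {x} p → p λ A A∈ → proj₂ A∈) V∈S
  ; rel-⋂    = λ x →
      (λ y∈cl A A∈ → proj₂ A∈ y∈cl)
    , (λ p A A∈ → p A (proj₁ A∈ , λ y∈cl → y∈cl A A∈))
  }

-- The underlying relation of the composition; R ⨟ T is the relational
-- composition written T ∘ R in the usual order.
comp : ∀ {ℓ} {X Y : Set ℓ} (ℤ : SSpace ℓ) →
       REL Y (Point ℤ) (suc ℓ) → REL X Y (suc ℓ) → REL X (Point ℤ) (suc ℓ)
comp {ℓ} ℤ T R x z = (V : Pred (Point ℤ) ℓ) → S (𝒦 ℤ) V → (R ⨟ T) x ⊆ V → z ∈ V

private
  comp-⊆ : ∀ {ℓ} {X Y : Set ℓ} (ℤ : SSpace ℓ)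
           {T : REL Y (Point ℤ) (suc ℓ)} {R : REL X Y (suc ℓ)} {x a}
           {V : Pred (Point ℤ) a} → S (𝒦 ℤ) V →
           (R ⨟ T) x ⊆ V → comp ℤ T R x ⊆ V
  comp-⊆ ℤ (W , W∈𝒦 , p , q) r c =
    q (c (∁ W) (W , W∈𝒦 , (λ z → z) , (λ z → z)) (p ∘ r))

infixr 9 _∗_

_∗_ : ∀ {ℓ} {𝕏 𝕐 ℤ : SSpace ℓ} →
      MeetRelation 𝕐 ℤ → MeetRelation 𝕏 𝕐 → MeetRelation 𝕏 ℤ
_∗_ {ℓ} {𝕏} {𝕐} {ℤ} T R = record
  { rel      = T∗R
  ; □-closed = closed
  ; rel-⋂    = λ x →
      (λ z∈ A A∈ → proj₂ A∈ z∈)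
    , (λ p A A∈S q → p A (A∈S , comp-⊆ ℤ {T = rel T} {rel R} A∈S q))
  } where
    T∗R = comp ℤ (rel T) (rel R)
    closed : (V : Pred (Point ℤ) ℓ) → S (𝒦 ℤ) V → S (𝒦 𝕏) (□ T∗R V)
    closed V V∈S with □-closed T V V∈S
    ... | W , W∈𝒦 , p , q =
      ≐-S {A = □ (rel R) (∁ W)} {□ T∗R V}
          ( (λ r → comp-⊆ ℤ {T = rel T} {rel R} V∈S
                     λ (y , Rxy , Tyz) → q (r Rxy) Tyz)
          , (λ r Rxy → p λ Tyz → r λ A _ s → s (_ , Rxy , Tyz)))
          (□-closed R (∁ W) (W , W∈𝒦 , (λ z → z) , (λ z → z)))

infix 4 _≋_

_≋_ : ∀ {ℓ} {𝕏 𝕐 : SSpace ℓ} → Rel (MeetRelation 𝕏 𝕐) (suc ℓ)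
T ≋ R = rel T ⇔ rel R

module _ {ℓ : Level} where

  ≋-isEquivalence : {𝕏 𝕐 : SSpace ℓ} → IsEquivalence (_≋_ {𝕏 = 𝕏} {𝕐})
  ≋-isEquivalence = record
    { refl  = (λ z → z) , (λ z → z)
    ; sym   = λ (p , q) → q , p
    ; trans = λ (p , q) (r , s) → (λ z → r (p z)) , (λ z → q (s z))
    }

  ∗-cong : {𝕏 𝕐 ℤ : SSpace ℓ} {T T′ : MeetRelation 𝕐 ℤ} {R R′ : MeetRelation 𝕏 𝕐} →
           T ≋ T′ → R ≋ R′ → T ∗ R ≋ T′ ∗ R′
  ∗-cong (p , q) (r , s) =
      (λ c A A∈S h → c A A∈S λ (y , Rxy , Tyz) → h (y , r Rxy , p Tyz))
    , (λ c A A∈S h → c A A∈S λ (y , Rxy , Tyz) → h (y , s Rxy , q Tyz))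

  ∗-assoc : {𝕏 𝕐 ℤ 𝕎 : SSpace ℓ}
            {R : MeetRelation 𝕏 𝕐} {T : MeetRelation 𝕐 ℤ} {Q : MeetRelation ℤ 𝕎} →
            (Q ∗ T) ∗ R ≋ Q ∗ (T ∗ R)
  ∗-assoc {ℤ = ℤ} {𝕎} {R} {T} {Q} =
      (λ c A A∈S h → c A A∈S λ (y , Rxy , QTyw) →
         comp-⊆ 𝕎 {T = rel Q} {rel T} A∈S
           (λ (z , Tyz , Qzw) → h (z , (λ B _ k → k (y , Rxy , Tyz)) , Qzw))
           QTyw)
    , (λ c A A∈S h → c A A∈S λ (z , TRxz , Qzw) →
         comp-⊆ ℤ {T = rel T} {rel R} {V = □ (rel Q) A} (□-closed Q A A∈S)
           (λ (y , Rxy , Tyz) Qzw′ → h (y , Rxy , λ B _ k → k (_ , Tyz , Qzw′)))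
           TRxz Qzw)

  ∗-identityˡ : {𝕏 𝕐 : SSpace ℓ} {T : MeetRelation 𝕏 𝕐} → ⊒-meet ∗ T ≋ T
  ∗-identityˡ {𝕐 = 𝕐} {T} =
      (λ {x} c → proj₂ (rel-⋂ T x) λ A (A∈S , Tx⊆A) → c A A∈S
         λ (y , Txy , y⊒z) → ∈-upward 𝕐 A∈S (Tx⊆A Txy) y⊒z)
    , (λ Txz A A∈S h → h (_ , Txz , λ B B∈ → proj₂ B∈))

  ∗-identityʳ : {𝕏 𝕐 : SSpace ℓ} {T : MeetRelation 𝕏 𝕐} → T ∗ ⊒-meet ≋ T
  ∗-identityʳ {𝕏 = 𝕏} {T = T} =
      (λ {x} c → proj₂ (rel-⋂ T x) λ A (A∈S , Tx⊆A) → c A A∈S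
         λ (y , x⊒y , Tyz) → ∈-upward 𝕏 {V = □ (rel T) A} (□-closed T A A∈S) Tx⊆A x⊒y Tyz)
    , (λ Txz A A∈S h → h (_ , (λ B B∈ → proj₂ B∈) , Txz))

record MoSSpace (ℓ : Level) : Set (suc (suc ℓ)) where
  field
    space : SSpace ℓ
    T     : MeetRelation space space

record CompatibleRelation {ℓ} (𝕏 𝕐 : MoSSpace ℓ) : Set (suc (suc ℓ)) where
  private
    module 𝕏 = MoSSpace 𝕏
    module 𝕐 = MoSSpace 𝕐
  field
    M          : MeetRelation 𝕏.space 𝕐.space
    compatible : M ∗ 𝕏.T ≋ 𝕐.T ∗ M

MoSsp : (ℓ : Level) → Category (suc (suc ℓ)) (suc (suc ℓ)) (suc ℓ)
MoSsp ℓ = record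
  { Obj       = MoSSpace ℓ
  ; Hom       = CompatibleRelation
  ; _≈_       = λ R R′ → M R ≋ M R′
  ; id        = λ {𝕏} → record
    { M          = ⊒-meet
    ; compatible = trans {i = ⊒-meet ∗ T 𝕏} {T 𝕏} {T 𝕏 ∗ ⊒-meet}
                     (∗-identityˡ {T = T 𝕏})
                     (sym {x = T 𝕏 ∗ ⊒-meet} {T 𝕏} (∗-identityʳ {T = T 𝕏}))
    }
  ; _∘ᶜ_      = compose
  ; equiv     = record
    { refl  = λ {R} → refl {x = M R}
    ; sym   = λ {R} {R′} → sym {x = M R} {M R′}
    ; trans = λ {R} {R′} {R″} → trans {i = M R} {M R′} {M R″}
    }
  ; ∘-resp-≈  = λ {_} {_} {_} {R} {R′} {Q} {Q′} →
                  ∗-cong {T = M R} {M R′} {M Q} {M Q′}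
  ; assoc     = λ {_} {_} {_} {_} {R} {Q} {P} →
                  ∗-assoc {R = M R} {M Q} {M P}
  ; identityˡ = λ {_} {_} {R} → ∗-identityˡ {T = M R}
  ; identityʳ = λ {_} {_} {R} → ∗-identityʳ {T = M R}
  } where
    open MoSSpace
    open CompatibleRelation
    open module E {𝕏 𝕐 : SSpace ℓ} = IsEquivalence (≋-isEquivalence {𝕏 = 𝕏} {𝕐})
      using (refl; sym; trans)

    compose : ∀ {𝕏 𝕐 ℤ : MoSSpace ℓ} →
              CompatibleRelation 𝕐 ℤ → CompatibleRelation 𝕏 𝕐 →
              CompatibleRelation 𝕏 ℤ
    compose {𝕏} {𝕐} {ℤ} Q R = record
      { M          = M Q ∗ M R
      ; compatible =
          trans {i = (M Q ∗ M R) ∗ T 𝕏} {M Q ∗ (M R ∗ T 𝕏)} {T ℤ ∗ (M Q ∗ M R)}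
            (∗-assoc {R = T 𝕏} {M R} {M Q})
         (trans {i = M Q ∗ (M R ∗ T 𝕏)} {M Q ∗ (T 𝕐 ∗ M R)} {T ℤ ∗ (M Q ∗ M R)}
            (∗-cong {T = M Q} {M Q} {M R ∗ T 𝕏} {T 𝕐 ∗ M R}
               (refl {x = M Q}) (compatible R))
         (trans {i = M Q ∗ (T 𝕐 ∗ M R)} {(M Q ∗ T 𝕐) ∗ M R} {T ℤ ∗ (M Q ∗ M R)}
            (sym {x = (M Q ∗ T 𝕐) ∗ M R} {M Q ∗ (T 𝕐 ∗ M R)}
               (∗-assoc {R = M R} {T 𝕐} {M Q}))
         (trans {i = (M Q ∗ T 𝕐) ∗ M R} {(T ℤ ∗ M Q) ∗ M R} {T ℤ ∗ (M Q ∗ M R)}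
            (∗-cong {T = M Q ∗ T 𝕐} {T ℤ ∗ M Q} {M R} {M R}
               (compatible Q) (refl {x = M R}))
            (∗-assoc {R = M R} {M Q} {T ℤ}))))
      }

{-# OPTIONS --safe #-}

-- Sending a meet-relation M to the map V ↦ □ M V on closed sets turns ∗ into
-- composition, so the theorem follows once this functor is fully faithful and
-- every semilattice is isomorphic to the closed sets of some S-space.
--
-- Faithfulness: M x is the intersection of the closed V with x ∈ □ M V.
-- Fullness: a homomorphism h is induced by the relation "x ∈ h V implies y ∈ V
-- for all V"; if x ∉ h V, the filter {W | x ∈ h W} extends to an irreducible
-- filter omitting V, and by compactness and S4 every irreducible filter of
-- closed sets consists of the closed sets containing some point y.
-- Essential surjectivity: the irreducible filters of A, with the complements
-- of β a = {P | a ∈ P} as subbase, form an S-space whose closed sets are the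
-- β a.  Zorn's lemma provides enough irreducible filters; it is available
-- since excluded middle for types, rather than truncated propositions, also
-- yields choice.
module Submission where

open import Defs
open import Level using (Level; _⊔_; suc; 0ℓ; Lift; lift; lower)
open import Axiom.ExcludedMiddle using (ExcludedMiddle)
open import Axiom.Extensionality.Propositional using (Extensionality)
open import Algebra.Lattice.Bundles using (BoundedMeetSemilattice)
open import Algebra.Morphism.Structures using (module MonoidMorphisms)
import Algebra.Morphism.Construct.Composition as Composition
import Algebra.Lattice.Properties.Semilattice as SemilatticeProperties
open import Data.Bool.Base using (Bool; true; false; T; _∧_)
open import Data.Bool.Properties using (T-∧; T-irrelevant; ∧-assoc; ∧-comm; ∧-idem; ∧-identityʳ)
open import Data.Empty using (⊥-elim)
open import Data.List.Base using (List; []; _∷_; _++_)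
open import Data.List.Relation.Unary.All using (All; []; _∷_)
import Data.List.Relation.Unary.All.Properties as All
open import Data.List.Relation.Unary.Any using (Any; here; there)
import Data.List.Relation.Unary.Any.Properties as Any
open import Data.Product.Base using (Σ; _×_; _,_; proj₁; proj₂; ∃)
open import Data.Sum.Base using (_⊎_; inj₁; inj₂; [_,_]′; map)
open import Data.Unit.Base using (tt)
open import Function.Base using (_∘_; id)
import Function.Bundles as Fun
open import Relation.Binary.Bundles using (Setoid)
open import Relation.Binary.Core using (Rel)
open import Relation.Binary.Lattice.Bundles using (MeetSemilattice)
open import Relation.Binary.PropositionalEquality.Core
  using (_≡_; refl; sym; cong; subst)
open import Relation.Binary.PropositionalEquality.Properties using (isEquivalence)
import Relation.Binary.Reasoning.Setoid as SetoidReasoning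
open import Relation.Binary.Structures using (IsEquivalence; IsPartialOrder)
open import Relation.Nullary.Decidable.Core
  using (yes; no; ⌊_⌋; toWitness; fromWitness; decidable-stable; T?)
open import Relation.Nullary.Negation.Core using (¬_; contradiction)
open import Relation.Unary
  using (Pred; _∈_; _∉_; _⊆_; _≐_; _∩_; _∪_; ∁; _≬_; Satisfiable)
open import Relation.Unary.Polymorphic using (∅)

-- Equivalences from fully faithful, essentially surjective functors.

module _ {o h e o′ h′ e′} {C : Category o h e} {D : Category o′ h′ e′} where
  private
    module C where
      open Category C public
      module _ {A B : Obj} where
        open IsEquivalence (equiv {A} {B}) public
    module D where
      open Category D public
      module _ {A B : Obj} where
        open IsEquivalence (equiv {A} {B}) public

  -- Essential surjectivity is given as data, the isomorphisms `η`. The inverse functor conjugates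
  -- by `η` and lifts through `full`; each law is checked after applying `G`, which suffices by
  -- faithfulness.
  fullyFaithful⇒Equivalence :
    (G : Functor D C) (let module G = Functor G)
    (full : ∀ {A B} → C.Hom (G.F₀ A) (G.F₀ B) → D.Hom A B) →
    (∀ {A B} (f : C.Hom (G.F₀ A) (G.F₀ B)) → G.F₁ (full f) C.≈ f) →
    (∀ {A B} {f g : D.Hom A B} → G.F₁ f C.≈ G.F₁ g → f D.≈ g) →
    (F₀ : C.Obj → D.Obj)
    (η : ∀ A → C.Hom A (G.F₀ (F₀ A))) (η⁻¹ : ∀ A → C.Hom (G.F₀ (F₀ A)) A) →
    (∀ A → η⁻¹ A C.∘ᶜ η A C.≈ C.id) → (∀ A → η A C.∘ᶜ η⁻¹ A C.≈ C.id) →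
    Equivalence C D
  fullyFaithful⇒Equivalence G full G-full faithful F₀ η η⁻¹ invˡ invʳ = record
    { F      = F
    ; G      = G
    ; unit   = record
      { to      = η
      ; from    = η⁻¹
      ; natural = λ f → C.sym (C.trans (C.∘-resp-≈ (G-full _) C.refl)
                        (C.trans C.assoc (C.∘-resp-≈ C.refl
                        (C.trans C.assoc (C.trans (C.∘-resp-≈ C.refl (invˡ _))
                        C.identityʳ)))))
      ; from∘to = invˡ
      ; to∘from = invʳ
      }
    ; counit = record
      { to      = λ B → full (η⁻¹ (G.F₀ B))
      ; from    = λ B → full (η (G.F₀ B))
      ; natural = λ f → faithful
          (C.trans (G₁-∘-full (C.refl) (G-full _))
          (C.trans cancel
          (C.sym (C.trans G.F-∘ (C.∘-resp-≈ C.refl (G-full _))))))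
      ; from∘to = λ B → faithful
          (C.trans (G₁-∘-full C.refl (G-full _)) (C.trans (invʳ _) (C.sym G.F-id)))
      ; to∘from = λ B → faithful
          (C.trans (G₁-∘-full C.refl (G-full _)) (C.trans (invˡ _) (C.sym G.F-id)))
      }
    }
    where
    module G = Functor G

    G₁-∘-full : ∀ {A B E} {f f′ : C.Hom (G.F₀ B) (G.F₀ E)} {g : D.Hom A B} {g′} →
                f C.≈ f′ → G.F₁ g C.≈ g′ → G.F₁ (full f D.∘ᶜ g) C.≈ f′ C.∘ᶜ g′
    G₁-∘-full p q = C.trans G.F-∘ (C.∘-resp-≈ (C.trans (G-full _) p) q)

    cancel : ∀ {A B} {k : C.Hom A B} → η⁻¹ B C.∘ᶜ (η B C.∘ᶜ k) C.≈ k
    cancel = C.trans (C.sym C.assoc)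
               (C.trans (C.∘-resp-≈ (invˡ _) C.refl) C.identityˡ)

    F : Functor C D
    F = record
      { F₀       = F₀
      ; F₁       = λ {A} {B} f → full (η B C.∘ᶜ (f C.∘ᶜ η⁻¹ A))
      ; F-resp-≈ = λ p → faithful (C.trans (G-full _) (C.trans
                     (C.∘-resp-≈ C.refl (C.∘-resp-≈ p C.refl)) (C.sym (G-full _))))
      ; F-id     = faithful (C.trans (G-full _) (C.trans
                     (C.∘-resp-≈ C.refl C.identityˡ)
                     (C.trans (invʳ _) (C.sym G.F-id))))
      ; F-∘      = faithful (C.trans (G-full _) (C.sym
                     (C.trans (G₁-∘-full C.refl (G-full _)) (C.trans C.assoc
                     (C.∘-resp-≈ C.refl (C.trans C.assoc (C.trans
                       (C.∘-resp-≈ C.refl cancel) (C.sym C.assoc))))))))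
      }

-- Classical logic and Boolean-valued subsets.

module Duality (em : ∀ a → ExcludedMiddle a) (funext : ∀ a b → Extensionality a b) where

  private
    variable
      a b r p i ℓ : Level

  -- Excluded middle turns a proposition of any universe into a Boolean, so predicates can be
  -- lowered to the smallest universe.
  ⟪_⟫ : Set a → Bool
  ⟪_⟫ {a} P = ⌊ em a {P} ⌋

  ⇑ : {P : Set a} → P → T ⟪ P ⟫
  ⇑ = fromWitness

  ⇓ : {P : Set a} → T ⟪ P ⟫ → P
  ⇓ = toWitness

  by-contra : {P : Set a} → ¬ ¬ P → P
  by-contra {a} = decidable-stable (em a)

  by-cases : {C : Set b} (P : Set a) → (P → C) → (¬ P → C) → C
  by-cases {a = a} P p ¬p with em a {P}
  ... | yes x = p x
  ... | no ¬x = ¬p ¬x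

  T-ext : {f g : Bool} → (T f → T g) → (T g → T f) → f ≡ g
  T-ext {false} {false} p q = refl
  T-ext {false} {true}  p q = ⊥-elim (q tt)
  T-ext {true}  {false} p q = ⊥-elim (p tt)
  T-ext {true}  {true}  p q = refl

  ∧⁺ : {f g : Bool} → T f → T g → T (f ∧ g)
  ∧⁺ x y = Fun.Equivalence.from T-∧ (x , y)

  ∧⁻ : {f g : Bool} → T (f ∧ g) → T f × T g
  ∧⁻ = Fun.Equivalence.to T-∧

  -- Bool-valued characteristic functions make the type of subsets of X as
  -- small as X, and make subsets with the same elements equal.
  Sub : (A : Set a) → Pred A p → Set a
  Sub A P = Σ A λ x → T ⟪ P x ⟫

  Sub-≡ : {A : Set a} {P : Pred A p} {x y : Sub A P} → proj₁ x ≡ proj₁ y → x ≡ y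
  Sub-≡ {x = x , _} refl = cong (x ,_) (T-irrelevant _ _)

  ⟦_⟧ : {X : Set a} {Q : Pred (X → Bool) p} → Sub (X → Bool) Q → Pred X 0ℓ
  ⟦ u ⟧ x = T (proj₁ u x)

  -- Zorn's lemma.

  module Zorn {D : Set a} {_≤_ : Rel D r} (≤-po : IsPartialOrder _≡_ _≤_) where
    open IsPartialOrder ≤-po using (antisym) renaming (refl to ≤-refl; trans to ≤-trans)

    IsChain : (D → Bool) → Set (a ⊔ r)
    IsChain C = ∀ x y → T (C x) → T (C y) → x ≤ y ⊎ y ≤ x

    IsLub : (D → Bool) → D → Set (a ⊔ r)
    IsLub C s = (∀ x → T (C x) → x ≤ s) × (∀ y → (∀ x → T (C x) → x ≤ y) → s ≤ y)

    module _ (lub : ∀ C → IsChain C → ∃ (IsLub C)) where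

      -- Excluded middle is applied to an untruncated existential, so it returns a strictly larger
      -- element whenever there is one; this is the choice function of the argument.
      next : D → D
      next x with em (a ⊔ r) {∃ λ y → x ≤ y × ¬ y ≤ x}
      ... | yes (y , _) = y
      ... | no _        = x

      next-inflationary : ∀ x → x ≤ next x
      next-inflationary x with em (a ⊔ r) {∃ λ y → x ≤ y × ¬ y ≤ x}
      ... | yes (_ , x≤y , _) = x≤y
      ... | no _              = ≤-refl

      next-≤⇒maximal : ∀ x → next x ≤ x → ∀ y → x ≤ y → y ≤ x
      next-≤⇒maximal x nx≤x with em (a ⊔ r) {∃ λ y → x ≤ y × ¬ y ≤ x}
      ... | yes (_ , _ , y≰x) = contradiction nx≤x y≰x
      ... | no none           = λ y x≤y → by-contra λ y≰x → none (y , x≤y , y≰x)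

      -- The least set closed under `next` and suprema of chains, as in the Bourbaki-Witt argument;
      -- the empty chain supplies its bottom element.
      data Tower : D → Set (a ⊔ r) where
        step : ∀ {x} → Tower x → Tower (next x)
        sup  : ∀ C (ch : IsChain C) → (∀ x → T (C x) → Tower x) →
               Tower (proj₁ (lub C ch))

      Comparable : D → D → Set r
      Comparable x y = next x ≤ y ⊎ y ≤ x

      -- Induction on `y`. At a successor `next b` with `b ≤ x`, the hypothesis gives `next b ≤ x`
      -- or `x ≤ b`, hence `b ≡ x`; at a supremum, either some member of the chain lies above
      -- `next x` or all lie below `x`.
      comparable-sym : ∀ {x} → Tower x → (∀ {y} → Tower y → Comparable y x) →
                       ∀ {y} → Tower y → Comparable x y
      comparable-sym tx cx (step {b} tb) with comparable-sym tx cx tb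
      ... | inj₁ nx≤b = inj₁ (≤-trans nx≤b (next-inflationary b))
      ... | inj₂ b≤x with cx tb
      ...   | inj₁ nb≤x = inj₂ nb≤x
      ...   | inj₂ x≤b with refl ← antisym b≤x x≤b = inj₁ ≤-refl
      comparable-sym {x} tx cx (sup C ch t)
        with em _ {∃ λ z → T (C z) × next x ≤ z}
      ... | yes (z , z∈C , nx≤z) =
            inj₁ (≤-trans nx≤z (proj₁ (proj₂ (lub C ch)) z z∈C))
      ... | no none = inj₂ (proj₂ (proj₂ (lub C ch)) x λ z z∈C →
            [ (λ nx≤z → contradiction (z , z∈C , nx≤z) none) , id ]′
              (comparable-sym tx cx (t z z∈C)))

      -- Induction on `x`. At `next b`, `comparable-sym` leaves only the case `y ≤ b`, where the
      -- induction hypothesis decides between `next y ≤ b` and `y ≡ b`.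
      comparable : ∀ {x} → Tower x → ∀ {y} → Tower y → Comparable y x
      comparable (step {b} tb) {y} ty with comparable-sym tb (comparable tb) ty
      ... | inj₁ nb≤y = inj₂ nb≤y
      ... | inj₂ y≤b with comparable tb ty
      ...   | inj₁ ny≤b = inj₁ (≤-trans ny≤b (next-inflationary b))
      ...   | inj₂ b≤y with refl ← antisym y≤b b≤y = inj₁ ≤-refl
      comparable (sup C ch t) {y} ty with em _ {∃ λ z → T (C z) × next y ≤ z}
      ... | yes (z , z∈C , ny≤z) =
            inj₁ (≤-trans ny≤z (proj₁ (proj₂ (lub C ch)) z z∈C))
      ... | no none = inj₂ (proj₂ (proj₂ (lub C ch)) y λ z z∈C →
            [ (λ ny≤z → contradiction (z , z∈C , ny≤z) none) , id ]′
              (comparable (t z z∈C) ty))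

      -- By `comparable` the whole tower is a chain, so its supremum `m` is again in the tower, as
      -- is `next m`; hence `next m ≤ m`, which happens only at a maximal element.
      maximal : ∃ λ m → ∀ x → m ≤ x → x ≤ m
      maximal = m , next-≤⇒maximal m (proj₁ m-lub _ (⇑ (step tower-m)))
        where
        tower = λ x → ⟪ Tower x ⟫
        chain : IsChain tower
        chain x y x∈ y∈ = map (≤-trans (next-inflationary x)) id
          (comparable (⇓ y∈) (⇓ x∈))
        m = proj₁ (lub tower chain)
        m-lub = proj₂ (lub tower chain)
        tower-m : Tower m
        tower-m = sup tower chain λ x → ⇓

  -- Filters of a semilattice and separation by irreducible filters.

  module Filters (A : BoundedMeetSemilattice ℓ ℓ) where
    open BoundedMeetSemilattice A using (Carrier; ⊤; identityʳ) renaming (_∧_ to _⋏_) public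
    private module A = BoundedMeetSemilattice A
    open MeetSemilattice
      (SemilatticeProperties.∧-orderTheoreticMeetSemilattice A.semilattice) public
      using (_≤_; x∧y≤x; x∧y≤y; ∧-greatest; antisym)
      renaming (refl to ≤-refl; trans to ≤-trans; reflexive to ≤-reflexive)

    ≤-⊤ : ∀ {x} → x ≤ ⊤
    ≤-⊤ = A.sym (identityʳ _)

    ⋏-monoʳ : ∀ {x y z} → y ≤ z → (x ⋏ y) ≤ (x ⋏ z)
    ⋏-monoʳ y≤z = ∧-greatest (x∧y≤x _ _) (≤-trans (x∧y≤y _ _) y≤z)

    ⋏-cut : ∀ {x y z h k m} → m ≤ h → m ≤ k → (x ⋏ h) ≤ y → (y ⋏ k) ≤ z → (x ⋏ m) ≤ z
    ⋏-cut m≤h m≤k xh≤y yk≤z = ≤-trans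
      (∧-greatest (≤-trans (⋏-monoʳ m≤h) xh≤y) (≤-trans (x∧y≤y _ _) m≤k)) yk≤z

    record IsFilter (F : Pred Carrier p) : Set (ℓ ⊔ p) where
      field
        ⊤∈ : ⊤ ∈ F
        ∧∈ : ∀ {x y} → x ∈ F → y ∈ F → x ⋏ y ∈ F
        up : ∀ {x y} → x ≤ y → x ∈ F → y ∈ F

      ∧∈⁻ : ∀ {x y} → x ⋏ y ∈ F → x ∈ F × y ∈ F
      ∧∈⁻ xy∈F = up (x∧y≤x _ _) xy∈F , up (x∧y≤y _ _) xy∈F

    -- Upward directedness modulo `F`: the algebraic form of the `Y`-family condition, with `F` in
    -- the role of the closed sets containing `Y`.
    Directed : Pred Carrier p → Pred Carrier i → Set (ℓ ⊔ p ⊔ i)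
    Directed F I = ∀ {x y} → x ∈ I → y ∈ I → ∃ λ h → ∃ λ c →
      h ∈ F × c ∈ I × (x ⋏ h) ≤ c × (y ⋏ h) ≤ c

    -- Meet-irreducibility in the lattice of filters, in elementary form: the
    -- filters generated by P, x and by P, y meet in more than P as soon as
    -- x, y ∉ P.
    record IsIrreducible (P : Pred Carrier p) : Set (ℓ ⊔ p) where
      field
        isFilter : IsFilter P
        proper   : Satisfiable (∁ P)
        directed : Directed P (∁ P)
      open IsFilter isFilter public

    Irreducible : Set ℓ
    Irreducible = Sub (Carrier → Bool) λ u → IsIrreducible (T ∘ u)

    isIrreducible : (P : Irreducible) → IsIrreducible ⟦ P ⟧
    isIrreducible P = ⇓ (proj₂ P)

    module _ {F : Pred Carrier p} {I : Pred Carrier i} (F-filter : IsFilter F)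
             (I-nonempty : Satisfiable I) (I-directed : Directed F I)
             (disjoint : ∀ {x} → x ∈ F → x ∉ I) where
      private
        module F = IsFilter F-filter

        record Separating (u : Carrier → Bool) : Set (ℓ ⊔ p ⊔ i) where
          field
            isFilter : IsFilter (T ∘ u)
            F⊆       : F ⊆ (T ∘ u)
            avoids   : ∀ {x} → T (u x) → x ∉ I
          open IsFilter isFilter public

        Candidate : Set ℓ
        Candidate = Sub (Carrier → Bool) Separating

        separating : (P : Candidate) → Separating (proj₁ P)
        separating P = ⇓ (proj₂ P)

        _⊑_ : Rel Candidate ℓ
        P ⊑ Q = ⟦ P ⟧ ⊆ ⟦ Q ⟧

        ⊑-isPartialOrder : IsPartialOrder _≡_ _⊑_
        ⊑-isPartialOrder = record
          { isPreorder = record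
            { isEquivalence = isEquivalence
            ; reflexive     = λ { refl → id }
            ; trans         = λ p q → q ∘ p
            }
          ; antisym    = λ p q → Sub-≡ (funext _ _ λ x → T-ext p q)
          }

        open Zorn ⊑-isPartialOrder

        lub : ∀ C → IsChain C → ∃ (IsLub C)
        lub C chain = ((λ x → ⟪ Union x ⟫) , ⇑ sep) ,
          (λ P P∈C x∈P → ⇑ (inj₂ (P , P∈C , x∈P))) ,
          (λ Q ub x∈ → [ Separating.F⊆ (separating Q) , (λ (P , P∈C , x∈P) → ub P P∈C x∈P) ]′
            (⇓ x∈))
          where
          -- `F` is adjoined so that the empty chain too has a supremum among the candidates.
          Union : Pred Carrier (ℓ ⊔ p)
          Union x = x ∈ F ⊎ ∃ λ P → T (C P) × x ∈ ⟦ P ⟧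

          ∪-∧∈ : ∀ {x y} → x ∈ Union → y ∈ Union → x ⋏ y ∈ Union
          ∪-∧∈ (inj₁ x∈F) (inj₁ y∈F) = inj₁ (F.∧∈ x∈F y∈F)
          ∪-∧∈ (inj₁ x∈F) (inj₂ (P , P∈C , y∈P)) =
            inj₂ (P , P∈C , let open Separating (separating P) in ∧∈ (F⊆ x∈F) y∈P)
          ∪-∧∈ (inj₂ (P , P∈C , x∈P)) (inj₁ y∈F) =
            inj₂ (P , P∈C , let open Separating (separating P) in ∧∈ x∈P (F⊆ y∈F))
          ∪-∧∈ (inj₂ (P , P∈C , x∈P)) (inj₂ (Q , Q∈C , y∈Q)) with chain P Q P∈C Q∈C
          ... | inj₁ P⊑Q = inj₂ (Q , Q∈C , Separating.∧∈ (separating Q) (P⊑Q x∈P) y∈Q)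
          ... | inj₂ Q⊑P = inj₂ (P , P∈C , Separating.∧∈ (separating P) x∈P (Q⊑P y∈Q))

          sep : Separating (λ x → ⟪ Union x ⟫)
          sep = record
            { isFilter = record
              { ⊤∈ = ⇑ (inj₁ F.⊤∈)
              ; ∧∈ = λ x∈ y∈ → ⇑ (∪-∧∈ (⇓ x∈) (⇓ y∈))
              ; up = λ x≤y x∈ → ⇑ (map (F.up x≤y)
                       (λ (P , P∈C , x∈P) →
                          P , P∈C , Separating.up (separating P) x≤y x∈P) (⇓ x∈))
              }
            ; F⊆     = λ x∈F → ⇑ (inj₁ x∈F)
            ; avoids = λ x∈ → [ disjoint
                       , (λ (P , _ , x∈P) → Separating.avoids (separating P) x∈P) ]′ (⇓ x∈)
            }

        M : Candidate
        M = proj₁ (maximal lub)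

        module M = Separating (separating M)

        Meets : Pred Carrier _
        Meets x = ∃ λ h → ∃ λ c → h ∈ ⟦ M ⟧ × c ∈ I × (x ⋏ h) ≤ c

        -- Otherwise the filter generated by `M` and `x` would still avoid `I`, and maximality would
        -- put `x` in `M`.
        ∉⇒meets : ∀ {x} → x ∉ ⟦ M ⟧ → Meets x
        ∉⇒meets {x} x∉M = by-contra λ none → x∉M
          (proj₂ (maximal lub) (_ , ⇑ (extension none))
            (λ {y} y∈M → ⇑ (y , y∈M , x∧y≤y _ _))
            (⇑ (⊤ , M.⊤∈ , x∧y≤x _ _)))
          where
          Extension : Pred Carrier ℓ
          Extension c = ∃ λ h → h ∈ ⟦ M ⟧ × (x ⋏ h) ≤ c

          extension : ¬ Meets x → Separating (λ c → ⟪ Extension c ⟫)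
          extension none = record
            { isFilter = record
              { ⊤∈ = ⇑ (⊤ , M.⊤∈ , ≤-⊤)
              ; ∧∈ = λ p q → let (h , h∈ , h≤) = ⇓ p ; (k , k∈ , k≤) = ⇓ q in
                  ⇑ (h ⋏ k , M.∧∈ h∈ k∈ , ∧-greatest
                    (≤-trans (⋏-monoʳ (x∧y≤x _ _)) h≤)
                    (≤-trans (⋏-monoʳ (x∧y≤y _ _)) k≤))
              ; up = λ y≤z p → let (h , h∈ , h≤) = ⇓ p in ⇑ (h , h∈ , ≤-trans h≤ y≤z)
              }
            ; F⊆     = λ {y} y∈F → ⇑ (y , M.F⊆ y∈F , x∧y≤y _ _)
            ; avoids = λ p c∈I → let (h , h∈ , h≤) = ⇓ p in none (h , _ , h∈ , c∈I , h≤)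
            }

        M-irreducible : IsIrreducible ⟦ M ⟧
        M-irreducible = record
          { isFilter = M.isFilter
          ; proper   = proj₁ I-nonempty , λ x∈M → M.avoids x∈M (proj₂ I-nonempty)
          ; directed = λ x∉ y∉ →
              -- Maximality brings `x` and `y` into `I`, at `c` and `d`; directedness of `I` modulo
              -- `F` joins these at an `e` in `I`, which `M` avoids.
              let (h , c , h∈ , c∈ , h≤) = ∉⇒meets x∉
                  (k , d , k∈ , d∈ , k≤) = ∉⇒meets y∉
                  (l , e , l∈ , e∈ , c≤ , d≤) = I-directed c∈ d∈
              in  (h ⋏ k) ⋏ l , e , M.∧∈ (M.∧∈ h∈ k∈) (M.F⊆ l∈)
                , (λ e∈M → M.avoids e∈M e∈)
                , ⋏-cut (≤-trans (x∧y≤x _ l) (x∧y≤x h k)) (x∧y≤y _ l) h≤ c≤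
                , ⋏-cut (≤-trans (x∧y≤x _ l) (x∧y≤y h k)) (x∧y≤y _ l) k≤ d≤
          }

      abstract
        -- Analogue of the prime filter theorem: Zorn's lemma gives a filter maximal among those
        -- containing `F` and disjoint from `I`, and maximality makes it irreducible.
        separation : ∃ λ (P : Irreducible) → F ⊆ ⟦ P ⟧ × (∀ {x} → x ∈ ⟦ P ⟧ → x ∉ I)
        separation = (proj₁ M , ⇑ M-irreducible) , M.F⊆ , M.avoids

    abstract
      -- The case where `I` is the single point `x`, directed with `h` the top element and `c` equal
      -- to `x`.
      separate-point : {F : Pred Carrier p} → IsFilter F → ∀ {x} → x ∉ F →
                       ∃ λ (P : Irreducible) → F ⊆ ⟦ P ⟧ × x ∉ ⟦ P ⟧
      separate-point F-filter {x} x∉F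
        with P , F⊆P , avoids ← separation {I = _≡ x} F-filter (x , refl)
               (λ { refl refl → ⊤ , x , IsFilter.⊤∈ F-filter , refl , x∧y≤x _ _ , x∧y≤x _ _ })
               (λ { x∈F refl → x∉F x∈F })
        = P , F⊆P , λ x∈P → avoids x∈P refl

  -- Semilattices of subsets under intersection.

  module SubsetSemilattice {X : Set ℓ} (Q : Pred (X → Bool) p)
    (full : Q λ _ → true) (∩-closed : ∀ {u v} → Q u → Q v → Q λ x → u x ∧ v x) where

    -- Serves both the closed sets of an S-space and, with a trivial `Q`, the powerset of a
    -- spectrum.
    subsetSemilattice : BoundedMeetSemilattice ℓ ℓ
    subsetSemilattice = record
      { Carrier = Sub (X → Bool) Q
      ; _≈_     = λ u v → ⟦ u ⟧ ≐ ⟦ v ⟧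
      ; _∧_     = λ u v → (λ x → proj₁ u x ∧ proj₁ v x)
                        , ⇑ (∩-closed (⇓ (proj₂ u)) (⇓ (proj₂ v)))
      ; ⊤       = (λ _ → true) , ⇑ full
      ; isBoundedMeetSemilattice = record
        { isCommutativeMonoid = record
          { isMonoid = record
            { isSemigroup = record
              { isMagma = record
                { isEquivalence = record
                  { refl  = id , id
                  ; sym   = λ (p , q) → q , p
                  ; trans = λ (p , q) (r , s) → r ∘ p , q ∘ s
                  }
                ; ∙-cong = λ (p , q) (r , s) →
                    (λ z → let (x , y) = ∧⁻ z in ∧⁺ (p x) (r y))
                  , (λ z → let (x , y) = ∧⁻ z in ∧⁺ (q x) (s y))
                }
              ; assoc = λ u v w → ≗⇒≐ λ x → ∧-assoc (proj₁ u x) (proj₁ v x) (proj₁ w x)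
              }
            ; identity = (λ _ → id , id) , (λ u → ≗⇒≐ λ x → ∧-identityʳ (proj₁ u x))
            }
          ; comm = λ u v → ≗⇒≐ λ x → ∧-comm (proj₁ u x) (proj₁ v x)
          }
        ; idem = λ u → ≗⇒≐ λ x → ∧-idem (proj₁ u x)
        }
      }
      where
      ≗⇒≐ : {f g : X → Bool} → (∀ x → f x ≡ g x) → (T ∘ f) ≐ (T ∘ g)
      ≗⇒≐ f≗g = subst T (f≗g _) , subst T (sym (f≗g _))

    open Filters subsetSemilattice public

    ≤⇒⊆ : ∀ {u v} → u ≤ v → ⟦ u ⟧ ⊆ ⟦ v ⟧
    ≤⇒⊆ (p , _) x∈u = proj₂ (∧⁻ (p x∈u))

    ⊆⇒≤ : ∀ {u v} → ⟦ u ⟧ ⊆ ⟦ v ⟧ → u ≤ v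
    ⊆⇒≤ p = (λ x∈u → ∧⁺ x∈u (p x∈u)) , proj₁ ∘ ∧⁻

  -- Closed sets of an S-space and the points realising their irreducible filters.

  S-resp-≐ : {X : Set ℓ} {𝒦 : Family X} {V : Pred X a} {W : Pred X b} →
             V ≐ W → S 𝒦 V → S 𝒦 W
  S-resp-≐ (p , q) (O , O∈𝒦 , r , s) = O , O∈𝒦 , r ∘ q , p ∘ s

  S-∁ : {X : Set ℓ} {𝒦 : Family X} {V : Pred X ℓ} → V ∈ 𝒦 → S 𝒦 (∁ V)
  S-∁ V∈𝒦 = _ , V∈𝒦 , id , id

  module ClosedSets (𝕏 : SSpace ℓ) where
    open SSpace 𝕏 public
    open IsSSpace isSSpace public

    private
      S-whole : S 𝒦 {0ℓ} λ _ → T true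
      S-whole = ∅ , S2-∅ , (λ _ → λ ()) , (λ _ → tt)

      S-∩ : {u v : Point → Bool} → S 𝒦 (T ∘ u) → S 𝒦 (T ∘ v) → S 𝒦 λ x → T (u x ∧ v x)
      S-∩ (V , V∈𝒦 , p , q) (W , W∈𝒦 , r , s) = V ∪ W , S2-∪ V W V∈𝒦 W∈𝒦
        , (λ x∈ → let (x∈u , x∈v) = ∧⁻ x∈ in [ p x∈u , r x∈v ]′)
        , (λ x∉ → ∧⁺ (q (x∉ ∘ inj₁)) (s (x∉ ∘ inj₂)))

    open SubsetSemilattice (λ u → S 𝒦 (T ∘ u)) S-whole S-∩ public

    isClosed : (V : Carrier) → S 𝒦 ⟦ V ⟧
    isClosed V = ⇓ (proj₂ V)

    -- Closed sets from any universe, such as those of the form `□ T V`, get a small representative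
    -- here.
    closed : {V : Pred Point b} → S 𝒦 V → Carrier
    closed {V = V} V∈S = (λ x → ⟪ V x ⟫) , ⇑ (S-resp-≐ (⇑ , ⇓) V∈S)

    infix 10 _↑

    _↑ : Carrier → Pred Point ℓ
    (V ↑) x = Lift ℓ (x ∈ ⟦ V ⟧)

    ↑∈S : ∀ V → S 𝒦 (V ↑)
    ↑∈S V = S-resp-≐ (lift , lower) (isClosed V)

    module _ (P : Irreducible) where
      private
        module P = IsIrreducible (isIrreducible P)

        Y : Pred Point ℓ
        Y x = ∀ V → V ∈ ⟦ P ⟧ → x ∈ ⟦ V ⟧

        -- `𝒜` exhibits `Y` as an intersection of closed sets, `𝒥` collects the closed sets to be
        -- avoided, and `𝒢` is an open cover of the complement of `Y`.
        𝒜 𝒥 𝒢 : Family Point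
        𝒜 A = S 𝒦 A × ∃ λ V → V ∈ ⟦ P ⟧ × A ≐ ⟦ V ⟧
        𝒥 A = S 𝒦 A × ∃ λ V → V ∉ ⟦ P ⟧ × A ≐ ⟦ V ⟧
        𝒢 O = O ∈ 𝒦 × ∃ λ V → V ∈ ⟦ P ⟧ × ⟦ V ⟧ ⊆ ∁ O

        Y∈𝒞 : 𝒞 𝒦 Y
        Y∈𝒞 = 𝒜 , (λ _ → proj₁)
            , (λ x∈Y A (_ , V , V∈P , _ , V⊆A) → V⊆A (x∈Y V V∈P))
            , (λ x∈ V V∈P → lower (x∈ (V ↑) (↑∈S V , V , V∈P , lower , lift)))

        𝒥-isYFamily : IsYFamily 𝒦 Y 𝒥
        𝒥-isYFamily = record
          { nonempty = let (V , V∉P) = P.proper in V ↑ , ↑∈S V , V , V∉P , lower , lift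
          ; ⊆S       = λ _ → proj₁
          ; directed = λ { A B (_ , V , V∉P , A⊆V , _) (_ , W , W∉P , B⊆W , _) →
              let (H , C , H∈P , C∉P , VH≤C , WH≤C) = P.directed V∉P W∉P
              in  H ↑ , C ↑ , ↑∈S H , (↑∈S C , C , C∉P , lower , lift)
                , (λ x∈Y → lift (x∈Y H H∈P))
                , (λ (x∈A , x∈H) → lift (≤⇒⊆ {V ⋏ H} {C} VH≤C (∧⁺ (A⊆V x∈A) (lower x∈H))))
                , (λ (x∈B , x∈H) → lift (≤⇒⊆ {W ⋏ H} {C} WH≤C (∧⁺ (B⊆W x∈B) (lower x∈H)))) }
          }

        ⋂-avoiding : ∀ {Os} → All (_∈ 𝒢) Os →
                     ∃ λ V → V ∈ ⟦ P ⟧ × (∀ {x} → x ∈ ⟦ V ⟧ → ¬ Any (x ∈_) Os)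
        ⋂-avoiding [] = ⊤ , P.⊤∈ , λ _ ()
        ⋂-avoiding ((_ , V , V∈P , V⊆∁O) ∷ Os∈)
          with W , W∈P , avoids ← ⋂-avoiding Os∈
          = V ⋏ W , P.∧∈ V∈P W∈P , λ x∈ → λ where
              (here x∈O)   → V⊆∁O (proj₁ (∧⁻ x∈)) x∈O
              (there x∈Os) → avoids (proj₂ (∧⁻ x∈)) x∈Os

        -- Compactness of `O`, the complement of `V`: it is covered by `𝒢`, and the members of `P`
        -- avoiding the finitely many sets of a subcover meet in a member of `P` inside `V`.
        Y⊆⇒∈ : ∀ V → Y ⊆ ⟦ V ⟧ → V ∈ ⟦ P ⟧
        Y⊆⇒∈ V Y⊆V with O , O∈𝒦 , V⊆∁O , ∁O⊆V ← isClosed V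
          with Os , Os∈𝒢 , cover ← S2-compact O O∈𝒦 𝒢 (λ _ → subbasic ∘ proj₁)
                 (λ {x} x∈O → by-contra λ none → V⊆∁O (Y⊆V λ W W∈P → by-contra λ x∉W →
                    let (O′ , O′∈𝒦 , W⊆ , ⊆W) = isClosed W
                    in  none (O′ , (O′∈𝒦 , W , W∈P , λ {_} → W⊆)
                             , by-contra λ x∉O′ → x∉W (⊆W x∉O′))) x∈O)
          with W , W∈P , avoids ← ⋂-avoiding Os∈𝒢
          = P.up {W} {V} (⊆⇒≤ {W} {V} λ x∈W → ∁O⊆V λ x∈O → avoids x∈W (cover _ x∈O)) W∈P

      abstract
        -- `S4` yields a point of `Y` outside every closed set not in `P`; its hypothesis, that `Y`
        -- is not contained in such a set, is the contrapositive of `Y⊆⇒∈`.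
        realisation : ∃ λ x → ∀ V → (V ∈ ⟦ P ⟧ → x ∈ ⟦ V ⟧) × (x ∈ ⟦ V ⟧ → V ∈ ⟦ P ⟧)
        realisation
          with x , x∈Y , x∉𝒥 ← S4 Y 𝒥 Y∈𝒞 𝒥-isYFamily
                 (λ { A (_ , V , V∉P , A⊆V , _) → by-contra λ none →
                      V∉P (Y⊆⇒∈ V λ {x} x∈Y → by-contra λ x∉V →
                        none (x , x∈Y , x∉V ∘ A⊆V)) })
          = x , λ V → x∈Y V , λ x∈V → by-contra λ V∉P →
              x∉𝒥 (V ↑) (↑∈S V , V , V∉P , lower , lift) (lift x∈V)

    abstract
      separate-closed : {F : Pred Carrier p} → IsFilter F → ∀ {V} → V ∉ F →
                        ∃ λ x → (∀ {W} → W ∈ F → x ∈ ⟦ W ⟧) × x ∉ ⟦ V ⟧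
      separate-closed F-filter {V} V∉F
        with P , F⊆P , V∉P ← separate-point F-filter V∉F
        with x , x∈⇔ ← realisation P
        = x , (λ {W} W∈F → proj₁ (x∈⇔ W) (F⊆P W∈F)) , λ x∈V → V∉P (proj₂ (x∈⇔ V) x∈V)

  -- Meet-relations and homomorphisms between semilattices of closed sets.

  open ClosedSets using () renaming (subsetSemilattice to 𝒮)

  private
    setoid : BoundedMeetSemilattice ℓ ℓ → Setoid ℓ ℓ
    setoid A = record { isEquivalence = BoundedMeetSemilattice.isEquivalence A }

  module _ {𝕏 𝕐 : SSpace ℓ} where
    private
      module 𝕏 = ClosedSets 𝕏
      module 𝕐 = ClosedSets 𝕐
    open MeetRelation

    □-S : (M : MeetRelation 𝕏 𝕐) {V : Pred 𝕐.Point b} → S 𝕐.𝒦 V → S 𝕏.𝒦 (□ (rel M) V)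
    □-S M {V} (O , O∈𝒦 , p , q) =
      S-resp-≐ {V = □ (rel M) (∁ O)} {W = □ (rel M) V}
        ((λ r Mxy → q (r Mxy)) , λ r Mxy → p (r Mxy)) (□-closed M (∁ O) (S-∁ O∈𝒦))

    abstract
      box : MeetRelation 𝕏 𝕐 → 𝕐.Carrier → 𝕏.Carrier
      box M V = 𝕏.closed (□-S M (𝕐.isClosed V))

      box⁺ : ∀ M V {x} → (∀ y → rel M x y → y ∈ ⟦ V ⟧) → x ∈ ⟦ box M V ⟧
      box⁺ M V {x} p = ⇑ {P = x ∈ □ (rel M) ⟦ V ⟧} (p _)

      box⁻ : ∀ M V {x} → x ∈ ⟦ box M V ⟧ → ∀ {y} → rel M x y → y ∈ ⟦ V ⟧
      box⁻ M V {x} = ⇓ {P = x ∈ □ (rel M) ⟦ V ⟧}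

    box-mono : ∀ M V W → ⟦ V ⟧ ⊆ ⟦ W ⟧ → ⟦ box M V ⟧ ⊆ ⟦ box M W ⟧
    box-mono M V W V⊆W r = box⁺ M W λ _ m → V⊆W (box⁻ M V r m)

    box-isHom : (M : MeetRelation 𝕏 𝕐) → IsSemilatticeHom (𝒮 𝕐) (𝒮 𝕏) (box M)
    box-isHom M = record
      { isMagmaHomomorphism = record
        { isRelHomomorphism = record
          { cong = λ {V} {W} (p , q) → box-mono M V W p , box-mono M W V q }
        ; homo = λ V W →
            (λ r → ∧⁺ (box-mono M (V 𝕐.⋏ W) V (proj₁ ∘ ∧⁻) r)
                      (box-mono M (V 𝕐.⋏ W) W (proj₂ ∘ ∧⁻) r))
          , (λ r → box⁺ M (V 𝕐.⋏ W) λ _ m →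
               ∧⁺ (box⁻ M V (proj₁ (∧⁻ r)) m) (box⁻ M W (proj₂ (∧⁻ r)) m))
        }
      ; ε-homo = (λ _ → tt) , (λ _ → box⁺ M 𝕐.⊤ λ _ _ → tt)
      }

    -- The closed sets containing `rel M x` are the `V` with `x` in `box M V`; the fewer they are,
    -- the larger their intersection.
    box-⊆⇒rel-⊇ : (M N : MeetRelation 𝕏 𝕐) → (∀ V → ⟦ box M V ⟧ ⊆ ⟦ box N V ⟧) →
                  ∀ {x y} → rel N x y → rel M x y
    box-⊆⇒rel-⊇ M N p {x} Nxy = proj₂ (rel-⋂ M x) λ V (V∈S , Mx⊆V) →
      let V̂ = 𝕐.closed V∈S
      in  ⇓ (box⁻ N V̂ (p V̂ (box⁺ M V̂ λ _ m → ⇑ (Mx⊆V m))) Nxy)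

    box-faithful : (M N : MeetRelation 𝕏 𝕐) → (∀ V → ⟦ box M V ⟧ ≐ ⟦ box N V ⟧) → M ≋ N
    box-faithful M N p = box-⊆⇒rel-⊇ N M (λ V → proj₂ (p V))
                       , box-⊆⇒rel-⊇ M N (λ V → proj₁ (p V))

    box-cong : (M N : MeetRelation 𝕏 𝕐) → M ≋ N → ∀ V → ⟦ box M V ⟧ ≐ ⟦ box N V ⟧
    box-cong M N (p , q) V = (λ r → box⁺ N V λ _ m → box⁻ M V r (q m))
                           , (λ r → box⁺ M V λ _ m → box⁻ N V r (p m))

    module _ (h : 𝕐.Carrier → 𝕏.Carrier) (h-isHom : IsSemilatticeHom (𝒮 𝕐) (𝒮 𝕏) h) where
      private
        module h = MonoidMorphisms.IsMonoidHomomorphism h-isHom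

        R : 𝕏.Point → 𝕐.Point → Set (suc ℓ)
        R x y = Lift (suc ℓ) (∀ V → x ∈ ⟦ h V ⟧ → y ∈ ⟦ V ⟧)

        h-filter : ∀ x → 𝕐.IsFilter λ V → x ∈ ⟦ h V ⟧
        h-filter x = record
          { ⊤∈ = proj₂ h.ε-homo tt
          ; ∧∈ = λ {V} {W} x∈hV x∈hW → proj₂ (h.homo V W) (∧⁺ x∈hV x∈hW)
          ; up = λ {V} {W} V≤W x∈hV →
              proj₂ (∧⁻ (proj₁ (h.homo V W) (proj₁ (h.⟦⟧-cong {V} {V 𝕐.⋏ W} V≤W) x∈hV)))
          }

        -- The half of fullness that rests on the space axioms: a closed set outside the filter
        -- `h-filter x` is missed by a point lying in all members of the filter, and such a point is
        -- an `R`-successor of `x`.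
        □R⊆h : ∀ V {x} → (∀ y → R x y → y ∈ ⟦ V ⟧) → x ∈ ⟦ h V ⟧
        □R⊆h V {x} Rx⊆V = by-contra λ x∉hV →
          let (y , Rxy , y∉V) = 𝕐.separate-closed (h-filter x) {V} x∉hV
          in  y∉V (Rx⊆V y (lift λ W → Rxy {W}))

      abstract
        fromHom : MeetRelation 𝕏 𝕐
        fromHom = record
          { rel      = R
          ; □-closed = λ V V∈S → let V̂ = 𝕐.closed V∈S in
              S-resp-≐ {V = ⟦ h V̂ ⟧} {W = □ R V}
                ( (λ x∈hV Rxy → ⇓ (lower Rxy V̂ x∈hV))
                , (λ Rx⊆V → □R⊆h V̂ λ _ Rxy → ⇑ (Rx⊆V Rxy)))
                (𝕏.isClosed (h V̂))
          ; rel-⋂    = λ x →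
                (λ Rxy A A∈ → proj₂ A∈ Rxy)
              , (λ y∈ → lift λ V x∈hV →
                  lower (y∈ (V 𝕐.↑) (𝕐.↑∈S V , λ Rxy → lift (lower Rxy V x∈hV))))
          }

        box-fromHom : ∀ V → ⟦ box fromHom V ⟧ ≐ ⟦ h V ⟧
        box-fromHom V = (λ r → □R⊆h V λ _ → box⁻ fromHom V r)
                      , (λ x∈hV → box⁺ fromHom V λ _ Rxy → lower Rxy V x∈hV)

  box-⊒ : {𝕏 : SSpace ℓ} → let open ClosedSets 𝕏 in
          ∀ V → ⟦ box (⊒-meet {𝕏 = 𝕏}) V ⟧ ≐ ⟦ V ⟧
  box-⊒ {𝕏 = 𝕏} V =
      (λ r → box⁻ (⊒-meet {𝕏 = 𝕏}) V r λ _ → proj₂)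
    , (λ x∈V → box⁺ (⊒-meet {𝕏 = 𝕏}) V λ _ x⊒y → lower (x⊒y (V ↑) (↑∈S V , lift x∈V)))
    where open ClosedSets 𝕏

  -- `comp` replaces the relational composite by the intersection of its closed supersets, which
  -- does not affect inclusion in a closed `V`.
  box-∗ : {𝕏 𝕐 ℤ : SSpace ℓ} (N : MeetRelation 𝕐 ℤ) (M : MeetRelation 𝕏 𝕐) →
          ∀ V → ⟦ box (N ∗ M) V ⟧ ≐ ⟦ box M (box N V) ⟧
  box-∗ {ℤ = ℤ} N M V =
      (λ r → box⁺ M (box N V) λ y Mxy → box⁺ N V λ z Nyz →
         box⁻ (N ∗ M) V r λ _ _ s → s (y , Mxy , Nyz))
    , (λ r → box⁺ (N ∗ M) V λ _ c → lower (c (V ↑) (↑∈S V)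
         λ (_ , Mxy , Nyz) → lift (box⁻ N V (box⁻ M (box N V) r Mxy) Nyz)))
    where open ClosedSets ℤ

  -- The spectrum of a semilattice as an S-space.

  module Spectrum (A : BoundedMeetSemilattice ℓ ℓ) where
    open Filters A
    private
      module A = BoundedMeetSemilattice A
      open IsIrreducible

    β : Carrier → Pred Irreducible 0ℓ
    β a P = a ∈ ⟦ P ⟧

    ∁β : Carrier → Pred Irreducible ℓ
    ∁β a P = Lift ℓ (a ∉ ⟦ P ⟧)

    -- Membership is taken up to `≐`, which builds in `𝒦-resp-≐`.
    𝒦ₛ : Family Irreducible
    𝒦ₛ V = Lift (suc ℓ) (∃ λ a → V ≐ ∁ (β a))

    ∁β∈𝒦 : ∀ a → ∁β a ∈ 𝒦ₛ
    ∁β∈𝒦 a = lift (a , lower , lift)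

    β∈S : ∀ a → S 𝒦ₛ (β a)
    β∈S a = ∁β a , ∁β∈𝒦 a , (λ x → λ { (lift ¬x) → ¬x x }) , λ ¬¬x → by-contra (¬¬x ∘ lift)

    S⇒β : {V : Pred Irreducible b} → S 𝒦ₛ V → ∃ λ a → V ≐ β a
    S⇒β (O , lift (a , p , q) , r , s) =
      a , (λ x∈V → by-contra (r x∈V ∘ q)) , (λ x∈β → s λ x∈O → p x∈O x∈β)

    -- The principal filter of `x` omits `y` unless `x ≤ y`, and then extends to an irreducible
    -- filter omitting `y`.
    β-⊆⇒≤ : ∀ {x y} → (∀ P → x ∈ ⟦ P ⟧ → y ∈ ⟦ P ⟧) → x ≤ y
    β-⊆⇒≤ {x} {y} βx⊆βy = by-contra λ x≰y →
      let (P , ↑x⊆P , y∉P) = separate-point ↑x-filter x≰y in y∉P (βx⊆βy P (↑x⊆P ≤-refl))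
      where
      ↑x-filter : IsFilter (x ≤_)
      ↑x-filter = record { ⊤∈ = ≤-⊤ ; ∧∈ = ∧-greatest ; up = λ p q → ≤-trans q p }

    -- Compactness: if finitely many members of 𝒜 never cover V, then some
    -- ultrafilter 𝒰 on the spectrum contains V and the complements of all
    -- members of 𝒜.  The a with β a ∈ 𝒰 form a filter, and 𝒰 converges to any
    -- irreducible filter extending it.
    ∁β-compact : ∀ a → {V : Pred Irreducible ℓ} → V ≐ ∁ (β a) → Compact 𝒦ₛ V
    ∁β-compact a {V} (V⊆ , ⊆V) 𝒜 𝒜-open V⊆⋃𝒜 = by-contra absurd
      where
      module 𝒫 = SubsetSemilattice {X = Irreducible} (λ _ → Lift 0ℓ Bool)
                   (lift true) (λ _ _ → lift true)

      subset : Pred Irreducible b → 𝒫.Carrier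
      subset W = (λ P → ⟪ W P ⟫) , ⇑ (lift true)

      ∅ₛ : 𝒫.Carrier
      ∅ₛ = (λ _ → false) , ⇑ (lift true)

      FinitelyCovered : Pred Irreducible b → Set _
      FinitelyCovered W = ∃ λ (As : List (Pred Irreducible ℓ)) →
        All (_∈ 𝒜) As × (∀ P → P ∈ W → Any (P ∈_) As)

      -- The filter generated by `V` and the complements of the members of `𝒜`.
      𝒢 : Pred 𝒫.Carrier _
      𝒢 u = FinitelyCovered (V ∩ ∁ ⟦ u ⟧)

      𝒢-filter : 𝒫.IsFilter 𝒢
      𝒢-filter = record
        { ⊤∈ = [] , [] , λ P (_ , P∉) → ⊥-elim (P∉ tt)
        ; ∧∈ = λ {u} {v} (As , As∈ , p) (Bs , Bs∈ , q) → As ++ Bs , All.++⁺ As∈ Bs∈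
             , λ P (P∈V , P∉uv) →
                 by-cases (P ∈ ⟦ u ⟧)
                   (λ P∈u → Any.++⁺ʳ As (q P (P∈V , λ P∈v → P∉uv (∧⁺ P∈u P∈v))))
                   (λ P∉u → Any.++⁺ˡ (p P (P∈V , P∉u)))
        ; up = λ {u} {v} u≤v (As , As∈ , p) → As , As∈ , λ P (P∈V , P∉v) →
               p P (P∈V , λ P∈u → P∉v (𝒫.≤⇒⊆ {u} {v} u≤v P∈u))
        }

      module _ (𝒰 : 𝒫.Irreducible) (∅∉𝒰 : ∅ₛ ∉ ⟦ 𝒰 ⟧) where
        private module 𝒰 = 𝒫.IsIrreducible (𝒫.isIrreducible 𝒰)

        enlarge : ∀ {u v} → u ∈ ⟦ 𝒰 ⟧ → ⟦ u ⟧ ⊆ ⟦ v ⟧ → v ∈ ⟦ 𝒰 ⟧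
        enlarge {u} {v} u∈𝒰 u⊆v = 𝒰.up {u} {v} (𝒫.⊆⇒≤ {u} {v} u⊆v) u∈𝒰

        meeting : ∀ {u v} → u ∈ ⟦ 𝒰 ⟧ → v ∈ ⟦ 𝒰 ⟧ → ¬ (⟦ u ⟧ ⊆ ∁ ⟦ v ⟧)
        meeting {u} {v} u∈𝒰 v∈𝒰 disjoint = ∅∉𝒰 (enlarge {u 𝒫.⋏ v} {∅ₛ} (𝒰.∧∈ u∈𝒰 v∈𝒰)
          λ P∈ → let (P∈u , P∈v) = ∧⁻ P∈ in disjoint P∈u P∈v)

        -- If both were outside `𝒰`, directedness would give `h` in `𝒰` whose parts in `u` and in
        -- `v` lie in some `c` outside `𝒰`; as `u` and `v` cover everything, `h` lies in `c`.
        prime : ∀ {u v} → (∀ P → P ∉ ⟦ u ⟧ → P ∈ ⟦ v ⟧) → u ∉ ⟦ 𝒰 ⟧ → v ∈ ⟦ 𝒰 ⟧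
        prime {u} {v} cover u∉𝒰 = by-contra λ v∉𝒰 →
          let (h , c , h∈𝒰 , c∉𝒰 , uh≤c , vh≤c) = 𝒰.directed {u} {v} u∉𝒰 v∉𝒰
          in  c∉𝒰 (enlarge {h} {c} h∈𝒰 λ {P} P∈h →
                by-cases (P ∈ ⟦ u ⟧)
                  (λ P∈u → 𝒫.≤⇒⊆ {u 𝒫.⋏ h} {c} uh≤c (∧⁺ P∈u P∈h))
                  (λ P∉u → 𝒫.≤⇒⊆ {v 𝒫.⋏ h} {c} vh≤c (∧⁺ (cover P P∉u) P∈h)))

        N : Pred Carrier 0ℓ
        N x = subset (β x) ∈ ⟦ 𝒰 ⟧

        N-filter : IsFilter N
        N-filter = record
          { ⊤∈ = enlarge {𝒫.⊤} 𝒰.⊤∈ λ {P} _ → ⇑ (IsIrreducible.⊤∈ (isIrreducible P))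
          ; ∧∈ = λ {x} {y} x∈N y∈N → enlarge {subset (β x) 𝒫.⋏ subset (β y)}
                   (𝒰.∧∈ x∈N y∈N) λ {P} P∈ → let (P∈x , P∈y) = ∧⁻ P∈ in
                   ⇑ (IsIrreducible.∧∈ (isIrreducible P) (⇓ P∈x) (⇓ P∈y))
          ; up = λ {x} {y} x≤y x∈N → enlarge {subset (β x)} x∈N λ {P} P∈x →
                   ⇑ (IsIrreducible.up (isIrreducible P) x≤y (⇓ P∈x))
          }

        -- Induction on the generation of open sets. For a subbasic `W`, the complement of `β x`,
        -- having `x` outside `P` keeps `β x` out of `𝒰`, and primeness puts `W` in it.
        converges : ∀ {P} → N ⊆ ⟦ P ⟧ → ∀ {W} → Open 𝒦ₛ W → P ∈ W → subset W ∈ ⟦ 𝒰 ⟧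
        converges {P} N⊆P {W} (subbasic (lift (x , W⊆ , ⊆W))) P∈W =
          prime {subset (β x)} {subset W} (λ Q Q∉βx → ⇑ (⊆W (Q∉βx ∘ ⇑)))
            (λ x∈N → W⊆ P∈W (N⊆P x∈N))
        converges N⊆P whole _ = enlarge {𝒫.⊤} 𝒰.⊤∈ λ _ → ⇑ _
        converges N⊆P (meet {W} {W′} o o′) (P∈W , P∈W′) =
          enlarge {subset W 𝒫.⋏ subset W′}
            (𝒰.∧∈ (converges N⊆P o P∈W) (converges N⊆P o′ P∈W′))
            λ Q∈ → let (Q∈W , Q∈W′) = ∧⁻ Q∈ in ⇑ (⇓ Q∈W , ⇓ Q∈W′)
        converges N⊆P (union ℬ opens (W⊆ , ⊆W)) P∈W with B , B∈ℬ , P∈B ← W⊆ P∈W =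
          enlarge {subset B} (converges N⊆P (opens B B∈ℬ) P∈B)
            λ Q∈B → ⇑ (⊆W (B , B∈ℬ , ⇓ Q∈B))

        -- Otherwise `a` is not in `N`, since `𝒰` contains the complement of `β a`. So some `P`
        -- extending `N` omits `a`, lies in `V` and hence in some `W` of `𝒜`; convergence puts `W`
        -- in `𝒰` along with its complement.
        𝒢⊈𝒰 : ¬ (𝒢 ⊆ ⟦ 𝒰 ⟧)
        𝒢⊈𝒰 𝒢⊆𝒰
          with P , N⊆P , a∉P ← separate-point N-filter {a}
                 (λ a∈N → meeting {subset (β a)} {subset (∁ (β a))} a∈N
                    (𝒢⊆𝒰 ([] , [] , λ Q (Q∈V , Q∉) → ⊥-elim (Q∉ (⇑ (V⊆ Q∈V)))))
                    λ Q∈ Q∉ → ⇓ Q∉ (⇓ Q∈))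
          with W , W∈𝒜 , P∈W ← V⊆⋃𝒜 (⊆V {P} a∉P)
          = meeting {subset W} {subset (∁ W)} (converges N⊆P (𝒜-open W W∈𝒜) P∈W)
              (𝒢⊆𝒰 (W ∷ [] , W∈𝒜 ∷ [] , λ Q (_ , Q∉) →
                 here (by-contra λ Q∉W → Q∉ (⇑ Q∉W))))
              λ Q∈ Q∉ → ⇓ Q∉ (⇓ Q∈)

      absurd : ¬ ¬ FinitelyCovered V
      absurd none
        -- `∅ₛ` in `𝒢` would say that `V` itself is finitely covered.
        with 𝒰 , 𝒢⊆𝒰 , ∅∉𝒰 ← 𝒫.separate-point 𝒢-filter {∅ₛ}
               (λ (As , As∈ , p) → none (As , As∈ , λ P P∈V → p P (P∈V , id)))
        = 𝒢⊈𝒰 𝒰 ∅∉𝒰 𝒢⊆𝒰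

    private
      ∁β∪∁β : ∀ {V W : Pred Irreducible ℓ} {x y} → V ≐ ∁ (β x) → W ≐ ∁ (β y) →
              (V ∪ W) ≐ ∁ (β (x ⋏ y))
      ∁β∪∁β {x = x} {y} (V⊆ , ⊆V) (W⊆ , ⊆W) =
          (λ {P} → λ where
            (inj₁ P∈V) xy∈P → V⊆ P∈V (proj₁ (∧∈⁻ (isIrreducible P) xy∈P))
            (inj₂ P∈W) xy∈P → W⊆ P∈W (proj₂ (∧∈⁻ (isIrreducible P) xy∈P)))
        , λ {P} xy∉P → by-cases (x ∈ ⟦ P ⟧)
            (λ x∈P → inj₂ (⊆W λ y∈P → xy∉P (∧∈ (isIrreducible P) x∈P y∈P)))
            (λ x∉P → inj₁ (⊆V x∉P))

      -- `separation` is applied to the `x` with `Y` inside `β x` and the `x` with `β x` in `𝒥`. The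
      -- resulting `P` lies in `Y`, because `Y` is an intersection of sets `β x`, and in no member
      -- of `𝒥`.
      S4ₛ : ∀ Y 𝒥 → 𝒞 𝒦ₛ Y → IsYFamily 𝒦ₛ Y 𝒥 → (∀ A → A ∈ 𝒥 → Y ≬ ∁ A) →
            Y ≬ (λ x → ∀ A → A ∈ 𝒥 → x ∈ ∁ A)
      S4ₛ Y 𝒥 (𝒜 , 𝒜⊆S , Y⊆⋂𝒜 , ⋂𝒜⊆Y) Y-family hits =
        let (P , F⊆P , avoids) = separation F-filter I-nonempty I-directed disjoint
        in  P
          , ⋂𝒜⊆Y (λ A A∈𝒜 → let (x , A⊆β , β⊆A) = S⇒β (𝒜⊆S A A∈𝒜)
                             in β⊆A (F⊆P λ Q Q∈Y → A⊆β (Y⊆⋂𝒜 Q∈Y A A∈𝒜)))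
          , λ A A∈𝒥 P∈A → let (x , A⊆β , β⊆A) = S⇒β (⊆S A A∈𝒥)
                           in avoids (A⊆β P∈A) (A , A∈𝒥 , A⊆β , β⊆A)
        where
        open IsYFamily Y-family renaming (directed to 𝒥-directed)

        F : Pred Carrier ℓ
        F x = ∀ P → P ∈ Y → x ∈ ⟦ P ⟧

        I : Pred Carrier (suc ℓ)
        I x = ∃ λ A → A ∈ 𝒥 × A ≐ β x

        F-filter : IsFilter F
        F-filter = record
          { ⊤∈ = λ P _ → ⊤∈ (isIrreducible P)
          ; ∧∈ = λ x∈F y∈F P P∈Y → ∧∈ (isIrreducible P) (x∈F P P∈Y) (y∈F P P∈Y)
          ; up = λ x≤y x∈F P P∈Y → up (isIrreducible P) x≤y (x∈F P P∈Y)
          }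

        I-nonempty : Satisfiable I
        I-nonempty = let (A , A∈𝒥) = nonempty ; (x , A≐β) = S⇒β (⊆S A A∈𝒥)
                     in  x , A , A∈𝒥 , A≐β

        I-directed : Directed F I
        I-directed {x} {y} (A , A∈𝒥 , _ , β⊆A) (B , B∈𝒥 , _ , β⊆B) =
          let (H , C , H∈S , C∈𝒥 , Y⊆H , AH⊆C , BH⊆C) = 𝒥-directed A B A∈𝒥 B∈𝒥
              (h , H⊆β , β⊆H) = S⇒β H∈S
              (c , C⊆β , β⊆C) = S⇒β (⊆S C C∈𝒥)
          in  h , c , (λ P P∈Y → H⊆β (Y⊆H P∈Y)) , (C , C∈𝒥 , C⊆β , β⊆C)
            , β-⊆⇒≤ (λ P xh∈P → let (x∈P , h∈P) = ∧∈⁻ (isIrreducible P) xh∈P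
                                 in C⊆β {P} (AH⊆C (β⊆A {P} x∈P , β⊆H {P} h∈P)))
            , β-⊆⇒≤ (λ P yh∈P → let (y∈P , h∈P) = ∧∈⁻ (isIrreducible P) yh∈P
                                 in C⊆β {P} (BH⊆C (β⊆B {P} y∈P , β⊆H {P} h∈P)))

        disjoint : ∀ {x} → x ∈ F → x ∉ I
        disjoint x∈F (A , A∈𝒥 , _ , β⊆A) =
          let (P , P∈Y , P∉A) = hits A A∈𝒥 in P∉A (β⊆A (x∈F P P∈Y))

      -- By function extensionality distinct points differ at some `x`, and `∁β x` then contains
      -- exactly one of them.
      T₀ₛ : T₀ 𝒦ₛ
      T₀ₛ P Q P≢Q with em _ {∃ λ x → ¬ (proj₁ P x ≡ proj₁ Q x)}
      ... | no none = contradiction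
              (Sub-≡ (funext _ _ λ x → by-contra λ P≢Q → none (x , P≢Q))) P≢Q
      ... | yes (x , P≢Q) = ∁β x , subbasic (∁β∈𝒦 x) , separated
        where
        separated : (P ∈ ∁β x × Q ∉ ∁β x) ⊎ (P ∉ ∁β x × Q ∈ ∁β x)
        separated with T? (proj₁ P x) | T? (proj₁ Q x)
        ... | yes x∈P | no x∉Q  = inj₂ ((λ { (lift x∉P) → x∉P x∈P }) , lift x∉Q)
        ... | no x∉P  | yes x∈Q = inj₁ (lift x∉P , λ { (lift x∉Q) → x∉Q x∈Q })
        ... | yes x∈P | yes x∈Q = contradiction (T-ext (λ _ → x∈Q) (λ _ → x∈P)) P≢Q
        ... | no x∉P  | no x∉Q  = contradiction
                (T-ext (λ x∈P → ⊥-elim (x∉P x∈P)) (λ x∈Q → ⊥-elim (x∉Q x∈Q))) P≢Q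

    spectrum : SSpace ℓ
    spectrum = record
      { Point    = Irreducible
      ; 𝒦        = 𝒦ₛ
      ; 𝒦-resp-≐ = λ { (p , q) (lift (x , r , s)) → lift (x , r ∘ q , p ∘ s) }
      ; isSSpace = record
        { S1-T₀      = T₀ₛ
        ; S1-cover   = λ P → let (x , x∉P) = proper (isIrreducible P)
                             in  ∁β x , ∁β∈𝒦 x , lift x∉P
        ; S2-compact = λ { V (lift (x , V≐∁β)) → ∁β-compact x V≐∁β }
        ; S2-∪       = λ { V W (lift (x , p)) (lift (y , q)) → lift (x ⋏ y , ∁β∪∁β p q) }
        ; S2-∅       = lift (⊤ , (λ ()) , λ {P} ⊤∉P → ⊥-elim (⊤∉P (⊤∈ (isIrreducible P))))
        ; S3         = λ { P V W (lift (x , V⊆ , ⊆V)) (lift (y , W⊆ , ⊆W)) (P∈V , P∈W) →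
            -- Directedness outside `P`, applied to `x` and `y`, is `S3` with `∁β h` for `W` and
            -- `∁β c` for `D`.
            let (h , c , h∈P , c∉P , xh≤c , yh≤c) = directed (isIrreducible P) (V⊆ P∈V) (W⊆ P∈W)
            in  ∁β h , ∁β c , ∁β∈𝒦 h , ∁β∈𝒦 c , (λ { (lift h∉P) → h∉P h∈P }) , lift c∉P
              , λ { {Q} (lift c∉Q) →
                  let module Q = IsIrreducible (isIrreducible Q) in
                  by-cases (h ∈ ⟦ Q ⟧)
                    (λ h∈Q → inj₁ ( ⊆V (λ x∈Q → c∉Q (Q.up xh≤c (Q.∧∈ x∈Q h∈Q)))
                                  , ⊆W (λ y∈Q → c∉Q (Q.up yh≤c (Q.∧∈ y∈Q h∈Q)))))
                    (λ h∉Q → inj₂ (lift h∉Q)) } }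
        ; S4         = S4ₛ
        }
      }

    -- The isomorphism of a semilattice with the closed sets of its spectrum.

    private
      module 𝕊 = ClosedSets spectrum
      module 𝒮ₛ = BoundedMeetSemilattice (𝒮 spectrum)
    open SetoidReasoning (setoid (𝒮 spectrum))

    abstract
      embed : Carrier → 𝕊.Carrier
      embed x = 𝕊.closed (β∈S x)

      embed⁺ : ∀ x P → x ∈ ⟦ P ⟧ → P ∈ ⟦ embed x ⟧
      embed⁺ x P = ⇑ {P = x ∈ ⟦ P ⟧}

      embed⁻ : ∀ x P → P ∈ ⟦ embed x ⟧ → x ∈ ⟦ P ⟧
      embed⁻ x P = ⇓ {P = x ∈ ⟦ P ⟧}

    embed-surjective : ∀ V → ∃ λ x → ⟦ embed x ⟧ ≐ ⟦ V ⟧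
    embed-surjective V = let (x , p , q) = S⇒β (𝕊.isClosed V) in
      x , (λ {P} P∈ → q {P} (embed⁻ x P P∈)) , λ {P} P∈V → embed⁺ x P (p {P} P∈V)

    embed-injective : ∀ {x y} → ⟦ embed x ⟧ ≐ ⟦ embed y ⟧ → x A.≈ y
    embed-injective {x} {y} (p , q) = antisym
      (β-⊆⇒≤ λ P x∈P → embed⁻ y P (p {P} (embed⁺ x P x∈P)))
      (β-⊆⇒≤ λ P y∈P → embed⁻ x P (q {P} (embed⁺ y P y∈P)))

    abstract
      unembed : 𝕊.Carrier → Carrier
      unembed V = proj₁ (embed-surjective V)

      embed-unembed : ∀ V → ⟦ embed (unembed V) ⟧ ≐ ⟦ V ⟧
      embed-unembed V = proj₂ (embed-surjective V)

    -- As `embed` is injective, equations for `unembed` need only be checked after applying `embed`.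
    unembed-≈ : ∀ V x → ⟦ V ⟧ ≐ ⟦ embed x ⟧ → unembed V A.≈ x
    unembed-≈ V x V≐x = embed-injective {unembed V} {x} (begin
      embed (unembed V) ≈⟨ embed-unembed V ⟩
      V                 ≈⟨ V≐x ⟩
      embed x           ∎)

    unembed-embed : ∀ x → unembed (embed x) A.≈ x
    unembed-embed x = unembed-≈ (embed x) x (𝒮ₛ.refl {embed x})

    embed-isHom : IsSemilatticeHom A (𝒮 spectrum) embed
    embed-isHom = record
      { isMagmaHomomorphism = record
        { isRelHomomorphism = record
          { cong = λ {x} {y} x≈y → embed-mono (≤-reflexive x≈y)
                                 , embed-mono (≤-reflexive (A.sym x≈y)) }
        ; homo = λ x y →
            (λ {P} r → let (x∈P , y∈P) = ∧∈⁻ (isIrreducible P) (embed⁻ (x ⋏ y) P r)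
                       in ∧⁺ (embed⁺ x P x∈P) (embed⁺ y P y∈P))
          , (λ {P} r → let (x∈ , y∈) = ∧⁻ r in
               embed⁺ (x ⋏ y) P (∧∈ (isIrreducible P) (embed⁻ x P x∈) (embed⁻ y P y∈)))
        }
      ; ε-homo = (λ _ → tt) , λ {P} _ → embed⁺ ⊤ P (⊤∈ (isIrreducible P))
      }
      where
      embed-mono : ∀ {x y} → x ≤ y → ⟦ embed x ⟧ ⊆ ⟦ embed y ⟧
      embed-mono {x} {y} x≤y {P} x∈ = embed⁺ y P (up (isIrreducible P) x≤y (embed⁻ x P x∈))

    unembed-isHom : IsSemilatticeHom (𝒮 spectrum) A unembed
    unembed-isHom = record
      { isMagmaHomomorphism = record
        { isRelHomomorphism = record
          { cong = λ {V} {W} V≐W → unembed-≈ V (unembed W) (begin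
              V                 ≈⟨ V≐W ⟩
              W                 ≈⟨ embed-unembed W ⟨
              embed (unembed W) ∎) }
        ; homo = λ V W → let V̌ = unembed V ; W̌ = unembed W in
            unembed-≈ (V 𝕊.⋏ W) (V̌ ⋏ W̌) (begin
              V 𝕊.⋏ W             ≈⟨ 𝒮ₛ.∧-cong {embed V̌} {V} {embed W̌} {W}
                                       (embed-unembed V) (embed-unembed W) ⟨
              embed V̌ 𝕊.⋏ embed W̌ ≈⟨ embed.homo V̌ W̌ ⟨
              embed (V̌ ⋏ W̌)       ∎)
        }
      ; ε-homo = unembed-≈ 𝕊.⊤ ⊤ (begin
          𝕊.⊤     ≈⟨ embed.ε-homo ⟨
          embed ⊤ ∎)
      }
      where module embed = MonoidMorphisms.IsMonoidHomomorphism embed-isHom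

  -- Modal operators and the dual equivalence.

  closedSets : MoSSpace ℓ → ModalSemilattice ℓ
  closedSets 𝕏 = record { semilattice = 𝒮 𝕏.space ; d = box 𝕏.T ; d-isHom = box-isHom 𝕏.T }
    where module 𝕏 = MoSSpace 𝕏

  module _ {𝕏 𝕐 : MoSSpace ℓ} where
    private
      module 𝕏 = MoSSpace 𝕏
      module 𝕐 = MoSSpace 𝕐
    open SetoidReasoning (setoid (𝒮 𝕏.space))

    boxHom : CompatibleRelation 𝕏 𝕐 → ModalHom (closedSets 𝕐) (closedSets 𝕏)
    boxHom R = record
      { fun   = box M
      ; isHom = box-isHom M
      ; modal = λ V → begin
          box M (box 𝕐.T V) ≈⟨ box-∗ 𝕐.T M V ⟨
          box (𝕐.T ∗ M) V   ≈⟨ box-cong (M ∗ 𝕏.T) (𝕐.T ∗ M) compatible V ⟨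
          box (M ∗ 𝕏.T) V   ≈⟨ box-∗ M 𝕏.T V ⟩
          box 𝕏.T (box M V) ∎
      }
      where open CompatibleRelation R

    -- Compatibility equates two meet-relations, so by `box-faithful` it may be checked on closed
    -- sets, where it becomes the modal law of `h`.
    relationOf : ModalHom (closedSets 𝕐) (closedSets 𝕏) → CompatibleRelation 𝕏 𝕐
    relationOf h = record
      { M          = M
      ; compatible = box-faithful (M ∗ 𝕏.T) (𝕐.T ∗ M) λ V → begin
          box (M ∗ 𝕏.T) V   ≈⟨ box-∗ M 𝕏.T V ⟩
          box 𝕏.T (box M V) ≈⟨ 𝕏d.⟦⟧-cong {box M V} {fun V} (box-fromHom fun isHom V) ⟩
          box 𝕏.T (fun V)   ≈⟨ modal V ⟨
          fun (box 𝕐.T V)   ≈⟨ box-fromHom fun isHom (box 𝕐.T V) ⟨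
          box M (box 𝕐.T V) ≈⟨ box-∗ 𝕐.T M V ⟨
          box (𝕐.T ∗ M) V   ∎
      }
      where
      open ModalHom h
      M = fromHom fun isHom
      module 𝕏d = MonoidMorphisms.IsMonoidHomomorphism (box-isHom 𝕏.T)

  closedSetFunctor : Functor (MoSsp ℓ) (MoSL ℓ ᵒᵖ)
  closedSetFunctor = record
    { F₀       = closedSets
    ; F₁       = boxHom
    ; F-resp-≈ = λ {_} {_} {R} {R′} → box-cong (M R) (M R′)
    ; F-id     = λ {𝕏} → box-⊒ {𝕏 = MoSSpace.space 𝕏}
    ; F-∘      = λ {_} {_} {_} {R} {Q} → box-∗ (M Q) (M R)
    }
    where open CompatibleRelation

  module _ (A : ModalSemilattice ℓ) where
    private module A = ModalSemilattice A
    open Spectrum A.semilattice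
    private
      module 𝒮ₛ = BoundedMeetSemilattice (𝒮 spectrum)
      module d = MonoidMorphisms.IsMonoidHomomorphism A.d-isHom
      module embed = MonoidMorphisms.IsMonoidHomomorphism embed-isHom

      -- `A.d` transported along the isomorphism; `fromHom` then realises it as the `box` of a
      -- meet-relation.
      d̂ : 𝒮ₛ.Carrier → 𝒮ₛ.Carrier
      d̂ = embed ∘ A.d ∘ unembed

      d̂-isHom : IsSemilatticeHom (𝒮 spectrum) (𝒮 spectrum) d̂
      d̂-isHom = Composition.isMonoidHomomorphism (λ {U} {V} {W} → 𝒮ₛ.trans {U} {V} {W})
        (Composition.isMonoidHomomorphism A.trans unembed-isHom A.d-isHom) embed-isHom

    open SetoidReasoning (setoid (𝒮 spectrum))
    private
      T̂ : MeetRelation spectrum spectrum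
      T̂ = fromHom d̂ d̂-isHom

    modalSpectrum : MoSSpace ℓ
    modalSpectrum = record { space = spectrum ; T = T̂ }

    embedHom : ModalHom A (closedSets modalSpectrum)
    embedHom = record
      { fun   = embed
      ; isHom = embed-isHom
      ; modal = λ x → begin
          embed (A.d x)                   ≈⟨ embed.⟦⟧-cong (d.⟦⟧-cong (unembed-embed x)) ⟨
          embed (A.d (unembed (embed x))) ≈⟨ box-fromHom d̂ d̂-isHom (embed x) ⟨
          box T̂ (embed x)                 ∎
      }

    unembedHom : ModalHom (closedSets modalSpectrum) A
    unembedHom = record
      { fun   = unembed
      ; isHom = unembed-isHom
      ; modal = λ V → unembed-≈ (box T̂ V) (A.d (unembed V)) (box-fromHom d̂ d̂-isHom V)
      }

  duality : ∀ ℓ → Equivalence (MoSL ℓ ᵒᵖ) (MoSsp ℓ)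
  duality ℓ = fullyFaithful⇒Equivalence closedSetFunctor relationOf
    (λ h → box-fromHom (ModalHom.fun h) (ModalHom.isHom h))
    (λ {_} {_} {R} {Q} → box-faithful (CompatibleRelation.M R) (CompatibleRelation.M Q))
    -- Arrows are reversed in `MoSL ℓ ᵒᵖ`, so the unit is `unembedHom` and its inverse is
    -- `embedHom`.
    modalSpectrum unembedHom embedHom
    (λ A → Spectrum.unembed-embed (ModalSemilattice.semilattice A))
    (λ A → Spectrum.embed-unembed (ModalSemilattice.semilattice A))

theorem3p1 : (∀ a → ExcludedMiddle a) → (∀ a b → Extensionality a b) →
    (ℓ : Level) → Equivalence (MoSL ℓ ᵒᵖ) (MoSsp ℓ)
theorem3p1 em funext = Duality.duality em funext
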